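{- Let $A=\{(a,b):a,b\in\{0,1,2\}\}$ and $B=\{(a,b):a,b\in\{1,2,3\}\}$. Then the four mesh patterns $(123,A)$, $(132,A)$, $(123,B)$, $(132,B)$ are pairwise equidistributed, and the four mesh patterns $(123,A\cup\{(3,3)\})$, $(132,A\cup\{(3,3)\})$, $(123,B\cup\{(0,0)\})$, $(132,B\cup\{(0,0)\})$ are pairwise equidistributed.
   Context: $S_n$ denotes the set of permutations of $[n]=\{1,\dots,n\}$, written $\pi=\pi_1\cdots\pi_n$. A mesh pattern of length $k$ is a pair $(\tau,R)$ with $\tau\in S_k$ and $R\subseteq\{0,1,\dots,k\}^2$ (the shaded boxes; box $(a,b)$ is the unit square $[a,a+1]\times[b,b+1]$ in the diagram of $\tau$). An occurrence of $(\tau,R)$ in $\pi\in S_n$ is a choice of indices $i_1<\dots<i_k$ such that $\pi_{i_1}\cdots\pi_{i_k}$ is order-isomorphic to $\tau$ and, with $i_0=0$, $i_{k+1}=n+1$, $v_1<\dots<v_k$ the values $\pi_{i_1},\dots,\pi_{i_k}$ sorted increasingly, $v_0=0$, $v_{k+1}=n+1$, for every $(a,b)\in R$ there is no index $m$ with $i_a<m<i_{a+1}$ and $v_b<\pi_m<v_{b+1}$. Mesh patterns $p,q$ are equidistributed (have the same distribution) if for all $n,\ell\ge0$ the number of $\pi\in S_n$ with exactly $\ell$ occurrences of $p$ equals the number with exactly $\ell$ occurrences of $q$. -}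

module Defs where

open import Data.Nat using (ℕ; zero; suc; _<_; _<?_; _≤_)
open import Data.Nat.Properties using (_≟_)
open import Data.Fin using (Fin; toℕ; zero; suc)
open import Data.Vec using (Vec; []; _∷_; lookup; toList; tabulate; allFin)
open import Data.List using (List; []; _∷_; length; filter; concatMap; map; allFin; cartesianProduct; _++_)
open import Data.List.Relation.Unary.All using (All)
open import Data.List.Relation.Unary.Any using (Any)
open import Data.List.Relation.Unary.All using (all?)
open import Data.List.Relation.Unary.Any using (any?)
open import Data.Product using (_×_; _,_; proj₁; proj₂)
open import Relation.Nullary using (Dec; yes; no; ¬_)
open import Relation.Nullary.Decidable using (_×-dec_; ¬?)
open import Relation.Binary.PropositionalEquality using (_≡_)

-- Words / permutations.
-- A word of length n with letters in Fin n is a Vec (Fin n) n; the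
-- permutation π = π₁⋯πₙ of [n] is encoded 0-based: the entry at position
-- i (0-based) is π_{i+1} - 1.

allVecs : (n k : ℕ) → List (Vec (Fin n) k)
allVecs n zero = [] ∷ []
allVecs n (suc k) = concatMap (λ x → map (x ∷_) (allVecs n k)) (Data.List.allFin n)

Injective : ∀ {n k} → Vec (Fin n) k → Set
Injective {n} {k} w =
  All (λ i → All (λ j → toℕ i < toℕ j → ¬ (toℕ (lookup w i) ≡ toℕ (lookup w j)))
                 (Data.List.allFin k))
      (Data.List.allFin k)

injective? : ∀ {n k} (w : Vec (Fin n) k) → Dec (Injective w)
injective? {n} {k} w =
  all? (λ i → all? (λ j → imp? (toℕ i <? toℕ j) (¬? (toℕ (lookup w i) ≟ toℕ (lookup w j))))
                   (Data.List.allFin k))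
       (Data.List.allFin k)
  where
  imp? : ∀ {P Q : Set} → Dec P → Dec Q → Dec (P → Q)
  imp? _ (yes q) = yes (λ _ → q)
  imp? (no ¬p) _ = yes (λ p → Data.Empty.⊥-elim (¬p p))
    where import Data.Empty
  imp? (yes p) (no ¬q) = no (λ f → ¬q (f p))

S : (n : ℕ) → List (Vec (Fin n) n)
S n = filter injective? (allVecs n n)

-- Mesh patterns.
-- τ ∈ S_k encoded 0-based as Vec (Fin k) k; shaded boxes R as a list of
-- pairs (a , b) with 0 ≤ a,b ≤ k, using the paper's coordinates.

record MeshPattern (k : ℕ) : Set where
  constructor mesh
  field
    τ : Vec (Fin k) k
    R : List (ℕ × ℕ)

-- position of the a-th chosen index (1-based indices, with i₀ = 0 and
-- i_{k+1} = n+1); here expressed with 1-based positions.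
-- For index vector is (0-based positions, strictly increasing),
-- pos is a = i_a (1-based) for a ∈ {0,…,k+1}.
bound : ∀ {k} → (m : ℕ) → Vec ℕ k → ℕ → ℕ
bound {k} m xs a = go a xs
  where
  go : ∀ {k'} → ℕ → Vec ℕ k' → ℕ
  go zero _ = 0
  go (suc zero) (x ∷ _) = x
  go (suc (suc a)) (_ ∷ ys) = go (suc a) ys
  go (suc a) [] = m

insert : ∀ {k} → ℕ → Vec ℕ k → Vec ℕ (suc k)
insert x [] = x ∷ []
insert x (y ∷ ys) with x Data.Nat.≤? y
... | yes _ = x ∷ y ∷ ys
... | no _ = y ∷ insert x ys

sortV : ∀ {k} → Vec ℕ k → Vec ℕ k
sortV [] = []
sortV (x ∷ xs) = insert x (sortV xs)

StrictlyIncreasing : ∀ {n k} → Vec (Fin n) k → Set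
StrictlyIncreasing {n} {k} is =
  All (λ a → All (λ b → toℕ a < toℕ b → toℕ (lookup is a) < toℕ (lookup is b))
                 (Data.List.allFin k))
      (Data.List.allFin k)

OrderIso : ∀ {n k} → Vec (Fin n) k → Vec (Fin k) k → Set
OrderIso {n} {k} w τ =
  All (λ a → All (λ b → (toℕ (lookup w a) < toℕ (lookup w b)) ⇔ (toℕ (lookup τ a) < toℕ (lookup τ b)))
                 (Data.List.allFin k))
      (Data.List.allFin k)
  where
  _⇔_ : Set → Set → Set
  P ⇔ Q = (P → Q) × (Q → P)

-- Box (a , b) is empty: no position m (1-based) with i_a < m < i_{a+1}
-- and v_b < π_m < v_{b+1}.  Positions and values are 1-based here:
-- position (1-based) of 0-based index x is toℕ x + 1, value likewise.
BoxEmpty : ∀ {n k} → Vec (Fin n) n → Vec (Fin n) k → ℕ × ℕ → Set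
BoxEmpty {n} {k} π is (a , b) =
  All (λ m → ¬ ( (bound (suc n) ps a < suc (toℕ m)) × (suc (toℕ m) < bound (suc n) ps (suc a))
               × (bound (suc n) vs b < suc (toℕ (lookup π m)))
               × (suc (toℕ (lookup π m)) < bound (suc n) vs (suc b))))
      (Data.List.allFin n)
  where
  ps : Vec ℕ k
  ps = Data.Vec.map (λ i → suc (toℕ i)) is
  vs : Vec ℕ k
  vs = sortV (Data.Vec.map (λ i → suc (toℕ (lookup π i))) is)

IsOccurrence : ∀ {n k} → MeshPattern k → Vec (Fin n) n → Vec (Fin n) k → Set
IsOccurrence p π is =
  StrictlyIncreasing is
  × OrderIso (Data.Vec.map (lookup π) is) (MeshPattern.τ p)
  × All (BoxEmpty π is) (MeshPattern.R p)

isOccurrence? : ∀ {n k} (p : MeshPattern k) (π : Vec (Fin n) n) (is : Vec (Fin n) k) →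
                Dec (IsOccurrence p π is)
isOccurrence? {n} {k} p π is =
  all? (λ a → all? (λ b → imp? (toℕ a <? toℕ b) (toℕ (lookup is a) <? toℕ (lookup is b)))
                   (Data.List.allFin k)) (Data.List.allFin k)
  ×-dec all? (λ a → all? (λ b → (imp? (toℕ (lookup w a) <? toℕ (lookup w b)) (toℕ (lookup τ a) <? toℕ (lookup τ b)))
                                   ×-dec (imp? (toℕ (lookup τ a) <? toℕ (lookup τ b)) (toℕ (lookup w a) <? toℕ (lookup w b))))
                   (Data.List.allFin k)) (Data.List.allFin k)
  ×-dec all? (λ { (a , b) → all? (λ m → ¬? (_ <? _ ×-dec _ <? _ ×-dec _ <? _ ×-dec _ <? _)) (Data.List.allFin n) })
             (MeshPattern.R p)
  where
  w = Data.Vec.map (lookup π) is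
  τ = MeshPattern.τ p
  imp? : ∀ {P Q : Set} → Dec P → Dec Q → Dec (P → Q)
  imp? _ (yes q) = yes (λ _ → q)
  imp? (no ¬p) _ = yes (λ p → Data.Empty.⊥-elim (¬p p))
    where import Data.Empty
  imp? (yes p) (no ¬q) = no (λ f → ¬q (f p))

occ : ∀ {n k} → MeshPattern k → Vec (Fin n) n → ℕ
occ {n} {k} p π = length (filter (isOccurrence? p π) (allVecs n k))

countWith : ∀ {k} → MeshPattern k → (n ℓ : ℕ) → ℕ
countWith p n ℓ = length (filter (λ π → occ p π ≟ ℓ) (S n))

Equidistributed : ∀ {k k'} → MeshPattern k → MeshPattern k' → Set
Equidistributed p q = ∀ (n ℓ : ℕ) → countWith p n ℓ ≡ countWith q n ℓ

p123 : Vec (Fin 3) 3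
p123 = zero ∷ suc zero ∷ suc (suc zero) ∷ []

p132 : Vec (Fin 3) 3
p132 = zero ∷ suc (suc zero) ∷ suc zero ∷ []

boxesA : List (ℕ × ℕ)
boxesA = cartesianProduct (0 ∷ 1 ∷ 2 ∷ []) (0 ∷ 1 ∷ 2 ∷ [])

boxesB : List (ℕ × ℕ)
boxesB = cartesianProduct (1 ∷ 2 ∷ 3 ∷ []) (1 ∷ 2 ∷ 3 ∷ [])

-- Build a permutation by adding points on the left: it is coded by the numbers c of points below each new
-- point, at the time it is added. Up to reversing (patterns with A) or complementing (patterns with B), an
-- occurrence is a point s together with the two other points u, v that are right of s and below the top one
-- of s, u, v. So s, u, v are the three lowest points when s is added, and whether s starts an occurrence
-- depends only on the code of s and on the left-to-right order ("state") of the two lowest points already present: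
--   (123,A), (123,B): code 2, state descending;   (132,B): code 2, state ascending;
--   (132,A): code 1, state descending.
-- A code 0 makes the state ascending, a code 1 descending, others keep it. Exchanging the codes 0 and 1
-- everywhere exchanges the two states; exchanging 1 and 2 wherever the state is descending preserves it.
-- The extra box (3,3) or (0,0) demands that every later code be at most the current height of the top
-- point; that height is at least 2, so exchanging codes that are at most 2 does not affect this.
module Submission where

open import Defs renaming (Injective to DefsInjective)
open import Data.Bool using (Bool; true; false; not; T)
open import Data.Empty using (⊥-elim)
open import Data.Fin using (Fin; zero; suc; toℕ; opposite; punchIn; punchOut)
import Data.Fin as Fin
open import Data.Fin.Properties
  using (toℕ-injective; toℕ<n; injective⇒≤; punchIn-punchOut; punchIn-injective; opposite-prop;
         opposite-involutive)
open import Data.List using (List; []; _∷_; length; map; filter; cartesianProduct)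
import Data.List as List
open import Data.List.Membership.Propositional using (_∈_)
open import Data.List.Membership.Propositional.Properties
  using (∈-filter⁺; ∈-filter⁻; ∈-concatMap⁺; ∈-map⁺; ∈-map⁻; ∈-allFin; ∈-cartesianProduct⁺;
         ∈-cartesianProduct⁻; ∈-lookup)
open import Data.List.Relation.Unary.All as All using (All; []; _∷_)
import Data.List.Relation.Unary.All.Properties as Allₚ
open import Data.List.Relation.Unary.AllPairs as AllPairs using ()
import Data.List.Relation.Unary.AllPairs.Properties as AllPairsₚ
open import Data.List.Relation.Unary.Any using (here; there; index)
import Data.List.Relation.Unary.Any as Any
open import Data.List.Relation.Unary.Any.Properties using (lookup-index)
open import Data.List.Relation.Unary.Unique.Propositional using (Unique; []; _∷_)
import Data.List.Relation.Unary.Unique.Propositional.Properties as Uniqueₚ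
open import Data.Nat
open import Data.Nat.Properties
open import Data.Product using (_×_; _,_; ∃; ∃₂; proj₁; proj₂)
open import Data.Sum using (_⊎_; inj₁; inj₂)
import Data.Sum as Sum
open import Data.Vec using (Vec; []; _∷_; lookup; tabulate)
import Data.Vec as Vec
import Data.Vec.Properties as Vecₚ
open import Function using (_∘_; id)
open import Relation.Binary using (tri<; tri≈; tri>)
open import Relation.Binary.PropositionalEquality
open import Relation.Nullary using (¬_; Dec; yes; no; contradiction)

-- Comparing the lengths of duplicate-free lists

lookup-unique-injective : ∀ {A : Set} {xs : List A} → Unique xs →
                          ∀ {i j} → List.lookup xs i ≡ List.lookup xs j → i ≡ j
lookup-unique-injective (x∉ ∷ xs!) {zero}  {zero}  eq = refl
lookup-unique-injective (x∉ ∷ xs!) {zero}  {suc j} eq = contradiction eq (All.lookup x∉ (∈-lookup j))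
lookup-unique-injective (x∉ ∷ xs!) {suc i} {zero}  eq = contradiction (sym eq) (All.lookup x∉ (∈-lookup i))
lookup-unique-injective (x∉ ∷ xs!) {suc i} {suc j} eq = cong suc (lookup-unique-injective xs! eq)

-- Choosing a related entry of `ys` for each entry of `xs` and taking its position gives a map of
-- indices. Two indices with the same image share a related entry, so `inj` and the uniqueness of
-- `xs` identify them.
length-mono-≤ : ∀ {A B : Set} {xs : List A} {ys : List B} (R : A → B → Set) → Unique xs →
                (∀ {x} → x ∈ xs → ∃ λ y → y ∈ ys × R x y) →
                (∀ {x x′ y} → x ∈ xs → x′ ∈ xs → R x y → R x′ y → x ≡ x′) →
                length xs ≤ length ys
length-mono-≤ {xs = xs} {ys} R xs! total inj = injective⇒≤ image-injective
  where
  related : ∀ i → ∃ λ y → y ∈ ys × R (List.lookup xs i) y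
  related i = total (∈-lookup i)

  image : Fin (length xs) → Fin (length ys)
  image i = index (proj₁ (proj₂ (related i)))

  related-image : ∀ i → R (List.lookup xs i) (List.lookup ys (image i))
  related-image i = subst (R _) (lookup-index (proj₁ (proj₂ (related i)))) (proj₂ (proj₂ (related i)))

  image-injective : ∀ {i j} → image i ≡ image j → i ≡ j
  image-injective {i} {j} eq = lookup-unique-injective xs!
    (inj (∈-lookup i) (∈-lookup j) (related-image i)
         (subst (R _ ∘ List.lookup ys) (sym eq) (related-image j)))

-- Used at two levels: to compare numbers of permutations, and to compare numbers of occurrences
-- inside two given permutations.
filter-mono-≤ : ∀ {A B : Set} {P : A → Set} {Q : B → Set}
                (P? : ∀ x → Dec (P x)) (Q? : ∀ y → Dec (Q y)) (xs : List A) (ys : List B)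
                (R : A → B → Set) → Unique xs →
                (∀ {x} → x ∈ xs → P x → ∃ λ y → y ∈ ys × Q y × R x y) →
                (∀ {x x′ y} → P x → P x′ → R x y → R x′ y → x ≡ x′) →
                length (filter P? xs) ≤ length (filter Q? ys)
filter-mono-≤ P? Q? xs ys R xs! total inj = length-mono-≤ R (Uniqueₚ.filter⁺ P? xs!)
  (λ x∈ → let x∈xs , px = ∈-filter⁻ P? {xs = xs} x∈
              y , y∈ , qy , r = total x∈xs px
          in y , ∈-filter⁺ Q? y∈ qy , r)
  (λ x∈ x′∈ → inj (proj₂ (∈-filter⁻ P? {xs = xs} x∈)) (proj₂ (∈-filter⁻ P? {xs = xs} x′∈)))

-- The enumeration of words and permutations

∈-allVecs : ∀ {n k} (v : Vec (Fin n) k) → v ∈ allVecs n k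
∈-allVecs []      = here refl
∈-allVecs (x ∷ v) = ∈-concatMap⁺ _
  (Any.map (λ { refl → ∈-map⁺ (x ∷_) (∈-allVecs v) }) (∈-allFin x))

allVecs-unique : ∀ n k → Unique (allVecs n k)
allVecs-unique n zero    = [] ∷ []
allVecs-unique n (suc k) = Uniqueₚ.concat⁺
  (Allₚ.map⁺ (All.tabulate λ _ → Uniqueₚ.map⁺ Vecₚ.∷-injectiveʳ (allVecs-unique n k)))
  (AllPairsₚ.map⁺ (AllPairs.map disjoint (Uniqueₚ.allFin⁺ n)))
  where
  disjoint : ∀ {x y} → x ≢ y → ∀ {v} → ¬ (v ∈ map (x ∷_) (allVecs n k) × v ∈ map (y ∷_) (allVecs n k))
  disjoint x≢y (v∈ , v∈′) with ∈-map⁻ _ v∈ | ∈-map⁻ _ v∈′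
  ... | _ , _ , refl | _ , _ , eq = x≢y (Vecₚ.∷-injectiveˡ eq)

OneToOne : ∀ {n k} → Vec (Fin n) k → Set
OneToOne v = ∀ {i j} → lookup v i ≡ lookup v j → i ≡ j

fromAllFin : ∀ {n} {P : Fin n → Set} → All P (List.allFin n) → ∀ i → P i
fromAllFin ps i = All.lookup ps (∈-allFin i)

toAllFin : ∀ {n} {P : Fin n → Set} → (∀ i → P i) → All P (List.allFin n)
toAllFin p = All.tabulate λ {i} _ → p i

oneToOne⁺ : ∀ {n k} (v : Vec (Fin n) k) → DefsInjective v → OneToOne v
oneToOne⁺ v inj {i} {j} eq with <-cmp (toℕ i) (toℕ j)
... | tri< i<j _ _ = contradiction (cong toℕ eq) (fromAllFin (fromAllFin inj i) j i<j)
... | tri≈ _ i≡j _ = toℕ-injective i≡j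
... | tri> _ _ j<i = contradiction (cong toℕ (sym eq)) (fromAllFin (fromAllFin inj j) i j<i)

oneToOne⁻ : ∀ {n k} (v : Vec (Fin n) k) → OneToOne v → DefsInjective v
oneToOne⁻ v inj = toAllFin λ i → toAllFin λ j i<j eq → <⇒≢ i<j (cong toℕ (inj (toℕ-injective eq)))

S-unique : ∀ n → Unique (S n)
S-unique n = Uniqueₚ.filter⁺ injective? (allVecs-unique n n)

-- Heights after the insertion of a point

-- The new height of a point of height `t` once a point with `c` points below it is inserted. This
-- is `punchIn` on plain numbers, so that heights before and after an insertion can be compared
-- without matching `Fin` types.
bump : ℕ → ℕ → ℕ
bump zero    t       = suc t
bump (suc c) zero    = zero
bump (suc c) (suc t) = suc (bump c t)

toℕ-punchIn : ∀ {n} (c : Fin (suc n)) (i : Fin n) → toℕ (punchIn c i) ≡ bump (toℕ c) (toℕ i)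
toℕ-punchIn zero    i       = refl
toℕ-punchIn (suc c) zero    = refl
toℕ-punchIn (suc c) (suc i) = cong suc (toℕ-punchIn c i)

bump-mono-< : ∀ c {s t} → s < t → bump c s < bump c t
bump-mono-< zero    s<t             = s≤s s<t
bump-mono-< (suc c) {zero}  {suc t} s<t = s≤s z≤n
bump-mono-< (suc c) {suc s} {suc t} (s≤s s<t) = s≤s (bump-mono-< c s<t)

bump-cancel-< : ∀ c {s t} → bump c s < bump c t → s < t
bump-cancel-< c {s} {t} lt with <-cmp s t
... | tri< s<t _ _  = s<t
... | tri≈ _ refl _ = contradiction lt (<-irrefl refl)
... | tri> _ _ t<s  = contradiction lt (<-asym (bump-mono-< c t<s))

bump-injective : ∀ c {s t} → bump c s ≡ bump c t → s ≡ t
bump-injective c {s} {t} eq with <-cmp s t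
... | tri< s<t _ _ = contradiction eq (<⇒≢ (bump-mono-< c s<t))
... | tri≈ _ s≡t _ = s≡t
... | tri> _ _ t<s = contradiction (sym eq) (<⇒≢ (bump-mono-< c t<s))

bump≢ : ∀ c t → bump c t ≢ c
bump≢ (suc c) (suc t) eq = bump≢ c t (suc-injective eq)

bump-≤ : ∀ {c t} → c ≤ t → bump c t ≡ suc t
bump-≤ {zero}  _         = refl
bump-≤ {suc c} (s≤s c≤t) = cong suc (bump-≤ c≤t)

bump-> : ∀ {c t} → t < c → bump c t ≡ t
bump-> {suc c} {zero}  _         = refl
bump-> {suc c} {suc t} (s≤s t<c) = cong suc (bump-> t<c)

t≤bump : ∀ c t → t ≤ bump c t
t≤bump zero    t       = n≤1+n t
t≤bump (suc c) zero    = z≤n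
t≤bump (suc c) (suc t) = s≤s (t≤bump c t)

-- Together with `≤⇒bump≮`, this turns "the old point is not below the new one" into a bound on the
-- code `c`; the corner box is read off the code in this way.
<bump⇒≤ : ∀ {c t} → ¬ (bump c t < c) → c ≤ t
<bump⇒≤ ≮ = ≮⇒≥ λ t<c → ≮ (subst (_< _) (sym (bump-> t<c)) t<c)

≤⇒bump≮ : ∀ {c t} → c ≤ t → ¬ (bump c t < c)
≤⇒bump≮ c≤t lt = <-asym lt (subst (_ <_) (sym (bump-≤ c≤t)) (s≤s c≤t))

-- Codes and their bijection with permutations

infixr 5 _▸_

-- c ▸ C puts a new leftmost point with exactly c lower points in front of the permutation coded by C.
data Code : ℕ → Set where
  ε   : Code 0
  _▸_ : ∀ {n} → Fin (suc n) → Code n → Code (suc n)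

heights : ∀ {n} → Code n → Vec (Fin n) n
heights ε       = []
heights (c ▸ C) = c ∷ Vec.map (punchIn c) (heights C)

height : ∀ {n} → Code n → Fin n → ℕ
height C i = toℕ (lookup (heights C) i)

height-suc : ∀ {n} (c : Fin (suc n)) (C : Code n) i →
             height (c ▸ C) (suc i) ≡ bump (toℕ c) (height C i)
height-suc c C i = trans (cong toℕ (Vecₚ.lookup-map i (punchIn c) (heights C)))
                         (toℕ-punchIn c (lookup (heights C) i))

height-injective : ∀ {n} (C : Code n) {i j} → height C i ≡ height C j → i ≡ j
height-injective (c ▸ C) {zero}  {zero}  eq = refl
height-injective (c ▸ C) {zero}  {suc j} eq =
  contradiction (trans (sym (height-suc c C j)) (sym eq)) (bump≢ (toℕ c) _)
height-injective (c ▸ C) {suc i} {zero}  eq =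
  contradiction (trans (sym (height-suc c C i)) eq) (bump≢ (toℕ c) _)
height-injective (c ▸ C) {suc i} {suc j} eq = cong suc (height-injective C
  (bump-injective (toℕ c) (trans (sym (height-suc c C i)) (trans eq (height-suc c C j)))))

height-surjective : ∀ {n} (C : Code n) {x} → x < n → ∃ λ i → height C i ≡ x
height-surjective (c ▸ C) {x} x<1+n with <-cmp x (toℕ c)
... | tri≈ _ x≡c _ = zero , sym x≡c
... | tri< x<c _ _ with height-surjective C (<-≤-trans x<c (≤-pred (toℕ<n c)))
...   | i , eq = suc i , trans (height-suc c C i) (trans (cong (bump (toℕ c)) eq) (bump-> x<c))
height-surjective (c ▸ C) {suc x} (s≤s x<n) | tri> _ _ (s≤s c≤x) with height-surjective C x<n
... | i , eq = suc i , trans (height-suc c C i) (trans (cong (bump (toℕ c)) eq) (bump-≤ c≤x))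

heights-injective : ∀ {n} {C D : Code n} → heights C ≡ heights D → C ≡ D
heights-injective {C = ε}     {ε}     eq = refl
heights-injective {C = c ▸ C} {d ▸ D} eq with refl ← Vecₚ.∷-injectiveˡ eq =
  cong (c ▸_) (heights-injective (map-injective (Vecₚ.∷-injectiveʳ eq)))
  where
  map-injective : ∀ {k} {v w : Vec (Fin _) k} → Vec.map (punchIn c) v ≡ Vec.map (punchIn c) w → v ≡ w
  map-injective {v = []}    {[]}    _ = refl
  map-injective {v = x ∷ v} {y ∷ w} e = cong₂ _∷_ (punchIn-injective c x y (Vecₚ.∷-injectiveˡ e))
                                                  (map-injective (Vecₚ.∷-injectiveʳ e))

vec-ext : ∀ {A : Set} {n} {v w : Vec A n} → (∀ i → lookup v i ≡ lookup w i) → v ≡ w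
vec-ext {v = v} {w} eq =
  trans (sym (Vecₚ.tabulate∘lookup v)) (trans (Vecₚ.tabulate-cong eq) (Vecₚ.tabulate∘lookup w))

-- The first letter is the code of the leftmost point. Punching it out of the other letters leaves a
-- permutation with one point fewer, which is coded recursively.
heights-surjective : ∀ {n} (v : Vec (Fin n) n) → OneToOne v → ∃ λ C → heights C ≡ v
heights-surjective []          inj = ε , refl
heights-surjective {suc n} (c ∷ v) inj =
  c ▸ proj₁ rec , cong (c ∷_) (trans (cong (Vec.map (punchIn c)) (proj₂ rec)) map-w≡v)
  where
  c≢ : ∀ i → c ≢ lookup v i
  c≢ i eq with () ← inj {zero} {suc i} eq

  w : Vec (Fin n) n
  w = tabulate λ i → punchOut (c≢ i)

  punchIn-w : ∀ i → punchIn c (lookup w i) ≡ lookup v i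
  punchIn-w i = trans (cong (punchIn c) (Vecₚ.lookup∘tabulate _ i)) (punchIn-punchOut (c≢ i))

  w-inj : OneToOne w
  w-inj {i} {j} eq with refl ← inj {suc i} {suc j}
    (trans (sym (punchIn-w i)) (trans (cong (punchIn c) eq) (punchIn-w j))) = refl

  rec : ∃ λ C → heights C ≡ w
  rec = heights-surjective w w-inj

  map-w≡v : Vec.map (punchIn c) w ≡ v
  map-w≡v = vec-ext λ i → trans (Vecₚ.lookup-map i (punchIn c) w) (punchIn-w i)

-- Occurrences as cores in a point set with two orders

-- The shapes 321, 312 and 231 of a starting point s followed by two further points u, v.
data Kind : Set where
  ₃₂₁ ₃₁₂ ₂₃₁ : Kind

-- Polymorphic because they select among positions, among values and among numbers; the `-map`
-- lemmas pass between these uses while `κ` is a variable.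
low mid top : ∀ {A : Set} → Kind → A → A → A → A
low ₃₂₁ s u v = v
low ₃₁₂ s u v = u
low ₂₃₁ s u v = v
mid ₃₂₁ s u v = u
mid ₃₁₂ s u v = v
mid ₂₃₁ s u v = s
top ₃₂₁ s u v = s
top ₃₁₂ s u v = s
top ₂₃₁ s u v = u

low-map : ∀ {A B : Set} (g : A → B) κ {s u v} → low κ (g s) (g u) (g v) ≡ g (low κ s u v)
low-map g ₃₂₁ = refl
low-map g ₃₁₂ = refl
low-map g ₂₃₁ = refl

mid-map : ∀ {A B : Set} (g : A → B) κ {s u v} → mid κ (g s) (g u) (g v) ≡ g (mid κ s u v)
mid-map g ₃₂₁ = refl
mid-map g ₃₁₂ = refl
mid-map g ₂₃₁ = refl

top-map : ∀ {A B : Set} (g : A → B) κ {s u v} → top κ (g s) (g u) (g v) ≡ g (top κ s u v)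
top-map g ₃₂₁ = refl
top-map g ₃₁₂ = refl
top-map g ₂₃₁ = refl

OneOf : ∀ {A : Set} → A → A → A → A → Set
OneOf m x y z = m ≡ x ⊎ m ≡ y ⊎ m ≡ z

low-oneOf : ∀ {A : Set} κ {s u v : A} → OneOf (low κ s u v) s u v
low-oneOf ₃₂₁ = inj₂ (inj₂ refl)
low-oneOf ₃₁₂ = inj₂ (inj₁ refl)
low-oneOf ₂₃₁ = inj₂ (inj₂ refl)

mid-oneOf : ∀ {A : Set} κ {s u v : A} → OneOf (mid κ s u v) s u v
mid-oneOf ₃₂₁ = inj₂ (inj₁ refl)
mid-oneOf ₃₁₂ = inj₂ (inj₂ refl)
mid-oneOf ₂₃₁ = inj₁ refl

byValue : ∀ {A : Set} κ {m s u v : A} → OneOf m s u v → OneOf m (low κ s u v) (mid κ s u v) (top κ s u v)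
byValue ₃₂₁ (inj₁ e)        = inj₂ (inj₂ e)
byValue ₃₂₁ (inj₂ (inj₁ e)) = inj₂ (inj₁ e)
byValue ₃₂₁ (inj₂ (inj₂ e)) = inj₁ e
byValue ₃₁₂ (inj₁ e)        = inj₂ (inj₂ e)
byValue ₃₁₂ (inj₂ (inj₁ e)) = inj₁ e
byValue ₃₁₂ (inj₂ (inj₂ e)) = inj₂ (inj₁ e)
byValue ₂₃₁ (inj₁ e)        = inj₂ (inj₁ e)
byValue ₂₃₁ (inj₂ (inj₁ e)) = inj₂ (inj₂ e)
byValue ₂₃₁ (inj₂ (inj₂ e)) = inj₁ e

-- An occurrence, in a point set with a horizontal order ≺ and a vertical order ⊏, of the shape κ such that
-- no further point is right of s and below the top point; the flag f also empties the opposite corner.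
record Core (κ : Kind) (f : Bool) {n} (_≺_ _⊏_ : Fin n → Fin n → Set) (s u v : Fin n) : Set where
  constructor core
  field
    s≺u    : s ≺ u
    u≺v    : u ≺ v
    low⊏mid : low κ s u v ⊏ mid κ s u v
    mid⊏top : mid κ s u v ⊏ top κ s u v
    region : ∀ m → s ≺ m → m ⊏ top κ s u v → m ≡ u ⊎ m ≡ v
    corner : T f → ∀ m → m ≺ s → ¬ (top κ s u v ⊏ m)

-- One transport for both symmetries: `g` is `opposite` for reversal and the identity for
-- complement, where only the vertical order changes. As `g` is onto, each point `m` of the target
-- is `g (g⁻¹ m)`, to which the conditions of the source apply.
core-transport : ∀ {κ f m n} {_≺_ _⊏_ : Fin m → Fin m → Set} {_≺′_ _⊏′_ : Fin n → Fin n → Set}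
                 (g : Fin m → Fin n) (g⁻¹ : Fin n → Fin m) → (∀ i → g (g⁻¹ i) ≡ i) →
                 (∀ {i j} → i ≺ j → g i ≺′ g j) → (∀ {i j} → i ⊏ j → g i ⊏′ g j) →
                 (∀ {i j} → g i ≺′ g j → i ≺ j) → (∀ {i j} → g i ⊏′ g j → i ⊏ j) →
                 ∀ {s u v} → Core κ f _≺_ _⊏_ s u v → Core κ f _≺′_ _⊏′_ (g s) (g u) (g v)
core-transport {κ} {f} {_≺_ = _≺_} {_⊏_} {_≺′_} {_⊏′_} g g⁻¹ gg⁻¹ ≺⇒ ⊏⇒ ≺⇐ ⊏⇐ {s} {u} {v} O = record
  { s≺u     = ≺⇒ (s≺u O)
  ; u≺v     = ≺⇒ (u≺v O)
  ; low⊏mid = subst₂ _⊏′_ (sym (low-map g κ {s} {u} {v})) (sym (mid-map g κ {s} {u} {v})) (⊏⇒ (low⊏mid O))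
  ; mid⊏top = subst₂ _⊏′_ (sym (mid-map g κ {s} {u} {v})) (sym (top-map g κ {s} {u} {v})) (⊏⇒ (mid⊏top O))
  ; region  = λ m → subst (λ m → g s ≺′ m → m ⊏′ top κ (g s) (g u) (g v) → m ≡ g u ⊎ m ≡ g v) (gg⁻¹ m)
      λ s≺m m⊏t → Sum.map (cong g) (cong g)
        (region O (g⁻¹ m) (≺⇐ s≺m) (⊏⇐ (subst (g (g⁻¹ m) ⊏′_) (top-map g κ {s} {u} {v}) m⊏t)))
  ; corner  = λ tf m → subst (λ m → m ≺′ g s → ¬ (top κ (g s) (g u) (g v) ⊏′ m)) (gg⁻¹ m)
      λ m≺s t⊏m → corner O tf (g⁻¹ m) (≺⇐ m≺s) (⊏⇐ (subst (_⊏′ g (g⁻¹ m)) (top-map g κ {s} {u} {v}) t⊏m))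
  }
  where open Core

-- Cores of a code and removal of the leftmost point

Below : ∀ {n} → Code n → Fin n → Fin n → Set
Below C i j = height C i < height C j

CoreC : ∀ {n} → Kind → Bool → Code n → Fin n → Fin n → Fin n → Set
CoreC κ f C = Core κ f Fin._<_ (Below C)

module _ {n} (c : Fin (suc n)) (C : Code n) where

  below-suc⁺ : ∀ {i j} → Below C i j → Below (c ▸ C) (suc i) (suc j)
  below-suc⁺ lt = subst₂ _<_ (sym (height-suc c C _)) (sym (height-suc c C _)) (bump-mono-< (toℕ c) lt)

  below-suc⁻ : ∀ {i j} → Below (c ▸ C) (suc i) (suc j) → Below C i j
  below-suc⁻ lt = bump-cancel-< (toℕ c) (subst₂ _<_ (height-suc c C _) (height-suc c C _) lt)

  -- The newest point lies left of `s`, hence outside the region right of `s`. It can only violate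
  -- the corner condition, which thereby becomes a bound on its code.
  core-suc⁻ : ∀ {κ f s u v} → CoreC κ f (c ▸ C) (suc s) (suc u) (suc v) →
              CoreC κ f C s u v × (T f → toℕ c ≤ height C (top κ s u v))
  core-suc⁻ {κ} {f} {s} {u} {v} (core s<u u<v l<m m<t reg cor) =
    core (≤-pred s<u) (≤-pred u<v)
         (below-suc⁻ (subst₂ (Below (c ▸ C)) (low-map suc κ {s} {u} {v}) (mid-map suc κ {s} {u} {v}) l<m))
         (below-suc⁻ (subst₂ (Below (c ▸ C)) (mid-map suc κ {s} {u} {v}) (top-map suc κ {s} {u} {v}) m<t))
         (λ m s<m m<t → Sum.map suc-inj suc-inj (reg (suc m) (s≤s s<m)
           (subst (Below (c ▸ C) (suc m)) (sym (top-map suc κ {s} {u} {v}))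
                 (below-suc⁺ m<t))))
         (λ tf m m<s t<m → cor tf (suc m) (s≤s m<s)
           (subst (λ t → Below (c ▸ C) t (suc m)) (sym (top-map suc κ {s} {u} {v})) (below-suc⁺ t<m)))
    , λ tf → <bump⇒≤ λ lt → cor tf zero (s≤s z≤n)
        (subst (_< toℕ c) (sym (trans (cong (height (c ▸ C)) (top-map suc κ {s} {u} {v})) (height-suc c C _))) lt)
    where
    suc-inj : ∀ {i j : Fin n} → Fin.suc i ≡ suc j → i ≡ j
    suc-inj refl = refl

  core-suc⁺ : ∀ {κ f s u v} → CoreC κ f C s u v → (T f → toℕ c ≤ height C (top κ s u v)) →
              CoreC κ f (c ▸ C) (suc s) (suc u) (suc v)
  core-suc⁺ {κ} {f} {s} {u} {v} (core s<u u<v l<m m<t reg cor) c≤t =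
    core (s≤s s<u) (s≤s u<v)
         (subst₂ (Below (c ▸ C)) (sym (low-map suc κ {s} {u} {v})) (sym (mid-map suc κ {s} {u} {v}))
                 (below-suc⁺ l<m))
         (subst₂ (Below (c ▸ C)) (sym (mid-map suc κ {s} {u} {v})) (sym (top-map suc κ {s} {u} {v}))
                 (below-suc⁺ m<t))
         region corner
    where
    region : ∀ m → suc s Fin.< m → Below (c ▸ C) m (top κ (suc s) (suc u) (suc v)) → m ≡ suc u ⊎ m ≡ suc v
    region (suc m) (s≤s s<m) m<t = Sum.map (cong suc) (cong suc)
      (reg m s<m (below-suc⁻ (subst (Below (c ▸ C) (suc m)) (top-map suc κ {s} {u} {v}) m<t)))
    corner : T f → ∀ m → m Fin.< suc s → ¬ Below (c ▸ C) (top κ (suc s) (suc u) (suc v)) m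
    corner tf zero _ lt = ≤⇒bump≮ (c≤t tf)
      (subst (_< toℕ c) (trans (cong (height (c ▸ C)) (top-map suc κ {s} {u} {v})) (height-suc c C _)) lt)
    corner tf (suc m) (s≤s m<s) t<m =
      cor tf m m<s (below-suc⁻ (subst (λ t → Below (c ▸ C) t (suc m)) (top-map suc κ {s} {u} {v}) t<m))

-- The state, and cores that start at the newest point

-- state C: whether the second lowest point is left of the lowest one (false if there are fewer than two points)
stepState : ℕ → Bool → Bool
stepState 0             _ = false
stepState 1             _ = true
stepState (suc (suc _)) b = b

state : ∀ {n} → Code n → Bool
state ε       = false
state (c ▸ C) = stepState (toℕ c) (state C)

bump≡ : ∀ c {t k} → k < c → bump c t ≡ k → t ≡ k
bump≡ c {t} k<c eq = bump-injective c (trans eq (sym (bump-> k<c)))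

-- If `u` is the newest point, its code is 1 and sets the state. Otherwise the heights 0 and 1
-- belong to older points, so the code of the newest one is at least 2 and leaves both heights and
-- the state alone.
state-true : ∀ {n} (C : Code n) {u v} → u Fin.< v → height C u ≡ 1 → height C v ≡ 0 → state C ≡ true
state-true (c ▸ C) {zero} u<v h1 _ rewrite h1 = refl
state-true (c ▸ C) {suc u} {suc v} (s≤s u<v) h1 h0
  with toℕ c | trans (sym (height-suc c C u)) h1 | trans (sym (height-suc c C v)) h0
... | 1          | b1 | b0 = refl
... | suc (suc k) | b1 | b0 = state-true C u<v (bump≡ (2 + k) (s≤s (s≤s z≤n)) b1) (bump≡ (2 + k) (s≤s z≤n) b0)

state-false : ∀ {n} (C : Code n) {u v} → u Fin.< v → height C u ≡ 0 → height C v ≡ 1 → state C ≡ false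
state-false (c ▸ C) {zero} u<v h0 _ rewrite h0 = refl
state-false (c ▸ C) {suc u} {suc v} (s≤s u<v) h0 h1
  with toℕ c | trans (sym (height-suc c C u)) h0 | trans (sym (height-suc c C v)) h1
... | 0           | b0 | b1 = refl
... | 1           | b0 | b1 = contradiction b1 (bump≢ 1 _)
... | suc (suc k) | b0 | b1 = state-false C u<v (bump≡ (2 + k) (s≤s z≤n) b0) (bump≡ (2 + k) (s≤s (s≤s z≤n)) b1)

-- The newest point is the top one in ₃₂₁ and ₃₁₂, hence code 2, and the middle one in ₂₃₁, hence
-- code 1. The state is the order of `u` and `v`, which are the two lowest points before the
-- insertion.
Head : Kind → ℕ → Bool → Set
Head ₃₂₁ c b = c ≡ 2 × b ≡ true
Head ₃₁₂ c b = c ≡ 2 × b ≡ false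
Head ₂₃₁ c b = c ≡ 1 × b ≡ true

record Lowest (κ : Kind) {n} (C : Code n) (s u v : Fin n) : Set where
  constructor lowest
  field
    low≡0 : height C (low κ s u v) ≡ 0
    mid≡1 : height C (mid κ s u v) ≡ 1
    top≡2 : height C (top κ s u v) ≡ 2

-- Apply `exhaust` to 0, 1 and 2 in turn: 0 can only be `a`, then 1 can only be `b`, and 2 is
-- neither, so it is not below `t`.
initial-segment : ∀ {a b t} → a < b → b < t → (∀ {x} → x < t → x ≡ a ⊎ x ≡ b) → a ≡ 0 × b ≡ 1 × t ≡ 2
initial-segment {a} {b} {t} a<b b<t exhaust
  with exhaust {0} (<-trans (≤-<-trans z≤n a<b) b<t)
... | inj₂ refl = contradiction a<b λ ()
... | inj₁ refl with exhaust {1} (≤-<-trans a<b b<t)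
...   | inj₂ refl with m≤n⇒m<n∨m≡n b<t
...     | inj₂ 2≡t = refl , refl , sym 2≡t
...     | inj₁ 2<t with exhaust 2<t
...       | inj₁ ()
...       | inj₂ ()

-- Every other point is right of the leftmost point `zero`, so the region condition leaves only the
-- low and the middle point below the top one. As all heights below that of the top point are taken,
-- the three heights are 0, 1, 2.
core⇒lowest : ∀ {κ f n} {C : Code (suc n)} {u v} → CoreC κ f C zero u v → Lowest κ C zero u v
core⇒lowest {κ} {C = C} {u} {v} (core _ _ l<m m<t reg _) =
  let l , m , t = initial-segment l<m m<t exhaust in lowest l m t
  where
  oneOf : ∀ i → Below C i (top κ zero u v) → OneOf i zero u v
  oneOf zero    _  = inj₁ refl
  oneOf (suc i) lt = inj₂ (reg (suc i) (s≤s z≤n) lt)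

  exhaust : ∀ {x} → x < height C (top κ zero u v) →
            x ≡ height C (low κ zero u v) ⊎ x ≡ height C (mid κ zero u v)
  exhaust {x} x<t with height-surjective C (<-trans x<t (toℕ<n _))
  ... | i , refl with byValue κ (oneOf i x<t)
  ...   | inj₁ e        = inj₁ (cong (height C) e)
  ...   | inj₂ (inj₁ e) = inj₂ (cong (height C) e)
  ...   | inj₂ (inj₂ e) = contradiction x<t (<-irrefl (cong (height C) e))

-- A point below height 2 has height 0 or 1, so it is the low or the middle point. The corner is
-- empty because nothing lies left of `zero`.
lowest⇒core : ∀ {κ f n} {C : Code (suc n)} {u v} → Fin.zero {n} Fin.< u → u Fin.< v →
              Lowest κ C zero u v → CoreC κ f C zero u v
lowest⇒core {κ} {n = n} {C}  {u} {v} 0<u u<v (lowest l m t) =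
  core 0<u u<v (subst₂ _<_ (sym l) (sym m) (s≤s z≤n)) (subst₂ _<_ (sym m) (sym t) (s≤s (s≤s z≤n)))
       region (λ _ _ ())
  where
  notStart : ∀ {i} → Fin.zero {n} Fin.< i → OneOf i zero u v → i ≡ u ⊎ i ≡ v
  notStart () (inj₁ refl)
  notStart _  (inj₂ e) = e

  region : ∀ i → Fin.zero {n} Fin.< i → Below C i (top κ zero u v) → i ≡ u ⊎ i ≡ v
  region i 0<i i<t with height C i in eq | subst (height C i <_) t i<t
  ... | 0 | _ = notStart 0<i (subst (λ i → OneOf i zero u v)
                  (height-injective C (trans l (sym eq))) (low-oneOf κ {zero} {u} {v}))
  ... | 1 | _ = notStart 0<i (subst (λ i → OneOf i zero u v)
                  (height-injective C (trans m (sym eq))) (mid-oneOf κ {zero} {u} {v}))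
  ... | suc (suc _) | lt = contradiction lt λ { (s≤s (s≤s ())) }

module _ {n} (c : Fin (suc n)) (C : Code n) where

  private
    lowered : ∀ {i k m} → toℕ c ≡ m → k < m → height (c ▸ C) (suc i) ≡ k → height C i ≡ k
    lowered refl k<c h = bump≡ (toℕ c) k<c (trans (sym (height-suc c C _)) h)

    kept : ∀ {i k m} → toℕ c ≡ m → k < m → height C i ≡ k → height (c ▸ C) (suc i) ≡ k
    kept refl k<c refl = trans (height-suc c C _) (bump-> k<c)

    raised : ∀ {i k m} → toℕ c ≡ m → m ≤ k → height C i ≡ k → height (c ▸ C) (suc i) ≡ suc k
    raised refl c≤k refl = trans (height-suc c C _) (bump-≤ c≤k)

    unraised : ∀ {i k m} → toℕ c ≡ m → m ≤ k → height (c ▸ C) (suc i) ≡ suc k → height C i ≡ k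
    unraised refl c≤k h = bump-injective (toℕ c) (trans (sym (height-suc c C _)) (trans h (sym (bump-≤ c≤k))))

    0<2 : 0 < 2
    0<2 = s≤s z≤n

    1<2 : 1 < 2
    1<2 = s≤s (s≤s z≤n)

    0<1 : 0 < 1
    0<1 = s≤s z≤n

  lowest⇒head : ∀ κ {u v} → u Fin.< v → Lowest κ (c ▸ C) zero (suc u) (suc v) → Head κ (toℕ c) (state C)
  lowest⇒head ₃₂₁ u<v (lowest l m t) = t , state-true C u<v (lowered t 1<2 m) (lowered t 0<2 l)
  lowest⇒head ₃₁₂ u<v (lowest l m t) = t , state-false C u<v (lowered t 0<2 l) (lowered t 1<2 m)
  -- The top point, now at height 2, was at height 1 before the newest point was inserted below it.
  lowest⇒head ₂₃₁ u<v (lowest l m t) = m , state-true C u<v (unraised m ≤-refl t) (lowered m 0<1 l)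

  two-points : 2 ≤ n → ∃₂ λ u v → u Fin.< v ×
               ((state C ≡ true × height C u ≡ 1 × height C v ≡ 0) ⊎
                (state C ≡ false × height C u ≡ 0 × height C v ≡ 1))
  two-points 2≤n with height-surjective C (≤-trans (s≤s z≤n) 2≤n) | height-surjective C 2≤n
  ... | i , h0 | j , h1 with <-cmp (toℕ i) (toℕ j)
  ...   | tri< i<j _ _ = i , j , i<j , inj₂ (state-false C i<j h0 h1 , h0 , h1)
  ...   | tri> _ _ j<i = j , i , j<i , inj₁ (state-true C j<i h1 h0 , h1 , h0)
  ...   | tri≈ _ i≡j _ with () ← trans (sym h0) (trans (cong (height C) (toℕ-injective i≡j)) h1)

  head⇒lowest : ∀ κ → 2 ≤ n → Head κ (toℕ c) (state C) →
                ∃₂ λ u v → u Fin.< v × Lowest κ (c ▸ C) zero (suc u) (suc v)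
  head⇒lowest κ 2≤n hd with two-points 2≤n
  head⇒lowest ₃₂₁ _ (c≡ , st) | u , v , u<v , inj₁ (_ , h1 , h0) =
    u , v , u<v , lowest (kept c≡ 0<2 h0) (kept c≡ 1<2 h1) c≡
  head⇒lowest ₃₁₂ _ (c≡ , st) | u , v , u<v , inj₂ (_ , h0 , h1) =
    u , v , u<v , lowest (kept c≡ 0<2 h0) (kept c≡ 1<2 h1) c≡
  head⇒lowest ₂₃₁ _ (c≡ , st) | u , v , u<v , inj₁ (_ , h1 , h0) =
    u , v , u<v , lowest (kept c≡ 0<1 h0) c≡ (raised c≡ ≤-refl h1)
  head⇒lowest ₃₂₁ _ (_ , st) | _ , _ , _ , inj₂ (st′ , _) with () ← trans (sym st) st′
  head⇒lowest ₃₁₂ _ (_ , st) | _ , _ , _ , inj₁ (st′ , _) with () ← trans (sym st) st′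
  head⇒lowest ₂₃₁ _ (_ , st) | _ , _ , _ , inj₂ (st′ , _) with () ← trans (sym st) st′

-- With no point the default state is `false`, and a single point must have code 0, which gives
-- `false` again.
state⇒2≤ : ∀ {n} (C : Code n) → state C ≡ true → 2 ≤ n
state⇒2≤ (zero ▸ ε) ()
state⇒2≤ (_ ▸ _ ▸ _) _ = s≤s (s≤s z≤n)

-- The state `false` of ₃₁₂ may be the default, but there the code 2 itself shows that two points
-- are present, a code being at most their number.
head⇒2≤ : ∀ κ {n} (c : Fin (suc n)) (C : Code n) → Head κ (toℕ c) (state C) → 2 ≤ n
head⇒2≤ ₃₂₁ c C (_ , st)  = state⇒2≤ C st
head⇒2≤ ₃₁₂ c C (c≡2 , _) = subst (_≤ _) c≡2 (≤-pred (toℕ<n c))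
head⇒2≤ ₂₃₁ c C (_ , st)  = state⇒2≤ C st

-- Occurrences as events along the code

-- Event κ f C s t: s starts an occurrence of κ whose top point has height t.
data Event (κ : Kind) (f : Bool) : ∀ {n} → Code n → Fin n → ℕ → Set where
  now   : ∀ {n} {c : Fin (suc n)} {C : Code n} → Head κ (toℕ c) (state C) → Event κ f (c ▸ C) zero 2
  later : ∀ {n} {c : Fin (suc n)} {C : Code n} {s t} → Event κ f C s t → (T f → toℕ c ≤ t) →
          Event κ f (c ▸ C) (suc s) (bump (toℕ c) t)

-- The points left of `s` are peeled off one at a time, each leaving its corner bound in a `later`.
-- Once `s` is leftmost, its code and the state decide, which is `now`.
core⇒event : ∀ {κ f n} (C : Code n) {s u v} → CoreC κ f C s u v → Event κ f C s (height C (top κ s u v))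
core⇒event {κ} (c ▸ C) {zero} {suc u} {suc v} O@(core _ (s≤s u<v) _ _ _ _) =
  subst (Event _ _ _ _) (sym (Lowest.top≡2 L)) (now (lowest⇒head c C κ u<v L))
  where L = core⇒lowest {C = c ▸ C} O
core⇒event {κ} (c ▸ C) {suc s} {suc u} {suc v} O =
  subst (Event _ _ _ _) (sym (trans (cong (height (c ▸ C)) (top-map suc κ {s} {u} {v})) (height-suc c C _)))
        (later (core⇒event C (proj₁ (core-suc⁻ c C O))) (proj₂ (core-suc⁻ c C O)))
core⇒event (c ▸ C) {zero} {zero} (core () _ _ _ _ _)
core⇒event (c ▸ C) {zero} {suc u} {zero} (core _ () _ _ _ _)
core⇒event (c ▸ C) {suc s} {zero} (core () _ _ _ _ _)
core⇒event (c ▸ C) {suc s} {suc u} {zero} (core _ () _ _ _ _)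

event⇒core : ∀ {κ f n} (C : Code n) {s t} → Event κ f C s t →
             ∃₂ λ u v → CoreC κ f C s u v × height C (top κ s u v) ≡ t
event⇒core {κ} (c ▸ C) (now hd) with head⇒lowest c C κ (head⇒2≤ κ c C hd) hd
... | u , v , u<v , L = suc u , suc v , lowest⇒core (s≤s z≤n) (s≤s u<v) L , Lowest.top≡2 L
event⇒core {κ} (c ▸ C) {suc s} (later ev c≤t) with event⇒core C ev
... | u , v , O , refl = suc u , suc v , core-suc⁺ c C O c≤t ,
      trans (cong (height (c ▸ C)) (top-map suc κ {s} {u} {v})) (height-suc c C _)

lowest-unique : ∀ κ {n} {C : Code n} {s u v u′ v′} →
                Lowest κ C s u v → Lowest κ C s u′ v′ → u ≡ u′ × v ≡ v′
lowest-unique κ {C = C} L L′ with κ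
  | height-injective C (trans (Lowest.low≡0 L) (sym (Lowest.low≡0 L′)))
  | height-injective C (trans (Lowest.mid≡1 L) (sym (Lowest.mid≡1 L′)))
  | height-injective C (trans (Lowest.top≡2 L) (sym (Lowest.top≡2 L′)))
... | ₃₂₁ | l | m | t = m , l
... | ₃₁₂ | l | m | t = l , m
... | ₂₃₁ | l | m | t = t , l

-- An occurrence is determined by its start, so occurrences can be counted by their starting points.
core-unique : ∀ {κ f n} (C : Code n) {s u v u′ v′} →
              CoreC κ f C s u v → CoreC κ f C s u′ v′ → u ≡ u′ × v ≡ v′
core-unique {κ} (c ▸ C) {zero} O O′ =
  lowest-unique κ {C = c ▸ C} (core⇒lowest {C = c ▸ C} O) (core⇒lowest {C = c ▸ C} O′)
core-unique (c ▸ C) {suc s} {suc u} {suc v} {suc u′} {suc v′} O O′ =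
  let u≡ , v≡ = core-unique C (proj₁ (core-suc⁻ c C O)) (proj₁ (core-suc⁻ c C O′))
  in cong suc u≡ , cong suc v≡
core-unique (c ▸ C) {suc s} {zero} (core () _ _ _ _ _)
core-unique (c ▸ C) {suc s} {suc u} {zero} (core _ () _ _ _ _)
core-unique (c ▸ C) {suc s} {suc u} {suc v} {zero} _ (core () _ _ _ _ _)
core-unique (c ▸ C) {suc s} {suc u} {suc v} {suc u′} {zero} _ (core _ () _ _ _ _)

-- Recodings that preserve events

-- Codes that no event already begun can tell apart: its top point has height at least 2, so any
-- code up to 2 raises it by one and respects the corner bound.
Close : ℕ → ℕ → Set
Close c d = c ≡ d ⊎ (c ≤ 2 × d ≤ 2)

close-bump : ∀ {c d t} → Close c d → 2 ≤ t → bump c t ≡ bump d t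
close-bump (inj₁ refl)        _   = refl
close-bump (inj₂ (c≤2 , d≤2)) 2≤t = trans (bump-≤ (≤-trans c≤2 2≤t)) (sym (bump-≤ (≤-trans d≤2 2≤t)))

close-≤ : ∀ {c d t} → Close c d → 2 ≤ t → c ≤ t → d ≤ t
close-≤ (inj₁ refl)      _   c≤t = c≤t
close-≤ (inj₂ (_ , d≤2)) 2≤t _   = ≤-trans d≤2 2≤t

-- The top point begins at height 2, and insertions never lower a point.
event-≥2 : ∀ {κ f n} {C : Code n} {s t} → Event κ f C s t → 2 ≤ t
event-≥2 (now _)      = ≤-refl
event-≥2 (later ev _) = ≤-trans (event-≥2 ev) (t≤bump _ _)

-- The start `s` and the height `t` are both preserved: `s` matches the occurrences, `t` carries the
-- corner bound. As `f` is quantified inside, one recoding serves the patterns with and without the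
-- extra box.
record Recoding (κ κ′ : Kind) : Set where
  field
    recode     : ∀ {n} → Code n → Code n
    involutive : ∀ {n} (C : Code n) → recode (recode C) ≡ C
    event⁺     : ∀ {f n} {C : Code n} {s t} → Event κ f C s t → Event κ′ f (recode C) s t
    event⁻     : ∀ {f n} {C : Code n} {s t} → Event κ′ f C s t → Event κ f (recode C) s t

recoding-refl : ∀ {κ} → Recoding κ κ
recoding-refl = record { recode = id ; involutive = λ _ → refl ; event⁺ = id ; event⁻ = id }

recoding-sym : ∀ {κ κ′} → Recoding κ κ′ → Recoding κ′ κ
recoding-sym r = record { recode = recode ; involutive = involutive ; event⁺ = event⁻ ; event⁻ = event⁺ }
  where open Recoding r

-- Each letter is replaced according to the state of the original tail.
module Recode (g : ∀ {n} → Bool → Fin n → Fin n)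
              (close : ∀ {n} b (c : Fin n) → Close (toℕ c) (toℕ (g b c))) where

  recode : ∀ {n} → Code n → Code n
  recode ε       = ε
  recode (c ▸ C) = g (state C) c ▸ recode C

  -- The second pass sees the state of the recoded tail, so the hypothesis combines a replacement
  -- under each of the two states.
  recode-involutive : (∀ {n} (c : Fin (suc n)) (C : Code n) → g (state (recode C)) (g (state C) c) ≡ c) →
                      ∀ {n} (C : Code n) → recode (recode C) ≡ C
  recode-involutive inv ε       = refl
  recode-involutive inv (c ▸ C) = cong₂ _▸_ (inv c C) (recode-involutive inv C)

  -- Only the letter of the start involves `Head`. Every later letter is exchanged for a close one,
  -- with the same effect on the height of the top point and on the bound.
  recode-event : ∀ κ κ′ → (∀ {n} (c : Fin (suc n)) (C : Code n) → Head κ (toℕ c) (state C) →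
                           Head κ′ (toℕ (g (state C) c)) (state (recode C))) →
                 ∀ {f n} {C : Code n} {s t} → Event κ f C s t → Event κ′ f (recode C) s t
  recode-event κ κ′ hd (now {c = c} {C} h) = now (hd c C h)
  recode-event κ κ′ hd (later {c = c} {C} ev c≤t) =
    subst (Event _ _ _ _) (sym (close-bump (close (state C) c) (event-≥2 ev)))
      (later (recode-event κ κ′ hd ev) (close-≤ (close (state C) c) (event-≥2 ev) ∘ c≤t))

-- The exchanges of codes 0 and 1, and of codes 1 and 2

-- The first point has its code in `Fin 1`, where 0 has no partner and stays.
swap01 : ∀ {n} → Bool → Fin n → Fin n
swap01 {suc zero}    _ zero          = zero
swap01 {suc (suc n)} _ zero          = suc zero
swap01               _ (suc zero)    = zero
swap01               _ (suc (suc c)) = suc (suc c)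

swap01-close : ∀ {n} b (c : Fin n) → Close (toℕ c) (toℕ (swap01 b c))
swap01-close {suc zero}    _ zero          = inj₁ refl
swap01-close {suc (suc n)} _ zero          = inj₂ (z≤n , s≤s z≤n)
swap01-close {suc (suc n)} _ (suc zero)    = inj₂ (s≤s z≤n , z≤n)
swap01-close               _ (suc (suc c)) = inj₁ refl

swap01-involutive : ∀ {n} a b (c : Fin n) → swap01 a (swap01 b c) ≡ c
swap01-involutive {suc zero}    _ _ zero          = refl
swap01-involutive {suc (suc n)} _ _ zero          = refl
swap01-involutive {suc (suc n)} _ _ (suc zero)    = refl
swap01-involutive               _ _ (suc (suc c)) = refl

swap01-2 : ∀ {n} b (c : Fin n) → toℕ c ≡ 2 → toℕ (swap01 b c) ≡ 2
swap01-2 _ (suc (suc c)) eq = eq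

module Recode01 = Recode swap01 swap01-close

-- The latest code below 2 sets the state, and its exchange flips it. With two points present, such
-- a code occurs at the second point or later, where 0 and 1 are both available.
state-swap01 : ∀ {n} (C : Code n) → 2 ≤ n → state (Recode01.recode C) ≡ not (state C)
state-swap01 (zero ▸ _ ▸ C)     _ = refl
state-swap01 (suc zero ▸ _ ▸ C) _ = refl
state-swap01 (suc (suc c) ▸ D@(_ ▸ _ ▸ C)) _ = state-swap01 D (s≤s (s≤s z≤n))
state-swap01 (_ ▸ ε) (s≤s ())

321↔312 : Recoding ₃₂₁ ₃₁₂
321↔312 = record
  { recode     = recode
  ; involutive = recode-involutive λ c C → swap01-involutive (state (recode C)) (state C) c
  ; event⁺     = recode-event ₃₂₁ ₃₁₂ λ { c C h@(c≡2 , st) →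
                   swap01-2 (state C) c c≡2 , trans (state-swap01 C (head⇒2≤ ₃₂₁ c C h)) (cong not st) }
  ; event⁻     = recode-event ₃₁₂ ₃₂₁ λ { c C h@(c≡2 , st) →
                   swap01-2 (state C) c c≡2 , trans (state-swap01 C (head⇒2≤ ₃₁₂ c C h)) (cong not st) }
  }
  where open Recode01

-- Code 2 exists from `Fin 3` on; in `Fin 2` the code 1 stays.
swap12 : ∀ {n} → Bool → Fin n → Fin n
swap12                     true (suc (suc zero)) = suc zero
swap12 {suc (suc (suc n))} true (suc zero)       = suc (suc zero)
swap12                     _    c                = c

swap12-close : ∀ {n} b (c : Fin n) → Close (toℕ c) (toℕ (swap12 b c))
swap12-close false zero = inj₁ refl
swap12-close false (suc c) = inj₁ refl
swap12-close true zero = inj₁ refl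
swap12-close {suc (suc zero)} true (suc zero) = inj₁ refl
swap12-close {suc (suc (suc n))} true (suc zero) = inj₂ (s≤s z≤n , ≤-refl)
swap12-close true (suc (suc zero)) = inj₂ (≤-refl , s≤s z≤n)
swap12-close true (suc (suc (suc c))) = inj₁ refl

swap12-involutive : ∀ {n} b (c : Fin n) → swap12 b (swap12 b c) ≡ c
swap12-involutive false zero = refl
swap12-involutive false (suc c) = refl
swap12-involutive true zero = refl
swap12-involutive {suc (suc zero)} true (suc zero) = refl
swap12-involutive {suc (suc (suc n))} true (suc zero) = refl
swap12-involutive {suc (suc (suc n))} true (suc (suc zero)) = refl
swap12-involutive true (suc (suc (suc c))) = refl

module Recode12 = Recode swap12 swap12-close

-- In state `true`, code 1 sets `true` anew and code 2 keeps it, so exchanging them changes nothing.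
swap12-step : ∀ {n} b (c : Fin n) → stepState (toℕ (swap12 b c)) b ≡ stepState (toℕ c) b
swap12-step false zero = refl
swap12-step false (suc c) = refl
swap12-step true zero = refl
swap12-step {suc (suc zero)} true (suc zero) = refl
swap12-step {suc (suc (suc n))} true (suc zero) = refl
swap12-step true (suc (suc zero)) = refl
swap12-step true (suc (suc (suc c))) = refl

state-swap12 : ∀ {n} (C : Code n) → state (Recode12.recode C) ≡ state C
state-swap12 ε       = refl
state-swap12 (c ▸ C) rewrite state-swap12 C = swap12-step (state C) c

swap12-2→1 : ∀ {n} {b} (c : Fin n) → toℕ c ≡ 2 → b ≡ true → toℕ (swap12 b c) ≡ 1
swap12-2→1 (suc (suc zero)) _ refl = refl

swap12-1→2 : ∀ {n} {b} (c : Fin n) → 3 ≤ n → toℕ c ≡ 1 → b ≡ true → toℕ (swap12 b c) ≡ 2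
swap12-1→2 (suc zero) (s≤s (s≤s (s≤s _))) _ refl = refl

321↔231 : Recoding ₃₂₁ ₂₃₁
321↔231 = record
  { recode     = recode
  ; involutive = recode-involutive λ c C → trans
                   (cong (λ b → swap12 b (swap12 (state C) c)) (state-swap12 C)) (swap12-involutive (state C) c)
  ; event⁺     = recode-event ₃₂₁ ₂₃₁ λ { c C (c≡2 , st) →
                   swap12-2→1 c c≡2 st , trans (state-swap12 C) st }
  ; event⁻     = recode-event ₂₃₁ ₃₂₁ λ { c C (c≡1 , st) →
                   -- The descending state certifies two older points, so code 2 is available to the
                   -- new point and 1 really becomes 2.
                   swap12-1→2 c (s≤s (state⇒2≤ C st)) c≡1 st , trans (state-swap12 C) st }
  }
  where open Recode12

-- From recodings to equidistribution

record Coding : Set where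
  field
    decode            : ∀ {n} → Code n → Vec (Fin n) n
    decode-injective  : ∀ {n} {C D : Code n} → decode C ≡ decode D → C ≡ D
    decode-oneToOne   : ∀ {n} (C : Code n) → OneToOne (decode C)
    decode-surjective : ∀ {n} (π : Vec (Fin n) n) → OneToOne π → ∃ λ C → decode C ≡ π

-- Taking the code under `M`, applying `φ` and decoding with `N` is injective and carries the value
-- of `F` to that of `G`.
fibre-mono-≤ : ∀ (M N : Coding) {n} (F G : Vec (Fin n) n → ℕ) (φ : Code n → Code n) →
               (∀ C → φ (φ C) ≡ C) → (∀ C → F (Coding.decode M C) ≡ G (Coding.decode N (φ C))) → ∀ ℓ →
               length (filter (λ π → F π ≟ ℓ) (S n)) ≤ length (filter (λ π → G π ≟ ℓ) (S n))
fibre-mono-≤ M N {n} F G φ involutive F≡G ℓ =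
  filter-mono-≤ (λ π → F π ≟ ℓ) (λ π → G π ≟ ℓ) (S n) (S n) Recoded (S-unique n) total injective
  where
  module M = Coding M
  module N = Coding N

  Recoded : Vec (Fin n) n → Vec (Fin n) n → Set
  Recoded π σ = ∃ λ C → M.decode C ≡ π × N.decode (φ C) ≡ σ

  total : ∀ {π} → π ∈ S n → F π ≡ ℓ → ∃ λ σ → σ ∈ S n × G σ ≡ ℓ × Recoded π σ
  total {π} π∈S Fπ≡ℓ with M.decode-surjective π
                            (oneToOne⁺ π (proj₂ (∈-filter⁻ injective? {xs = allVecs n n} π∈S)))
  ... | C , refl = N.decode (φ C) ,
        ∈-filter⁺ injective? (∈-allVecs _) (oneToOne⁻ (N.decode (φ C)) (N.decode-oneToOne (φ C))) ,
        trans (sym (F≡G C)) Fπ≡ℓ ,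
        C , refl , refl

  injective : ∀ {π π′ σ} → F π ≡ ℓ → F π′ ≡ ℓ → Recoded π σ → Recoded π′ σ → π ≡ π′
  injective _ _ (C , refl , refl) (D , refl , eq) = cong M.decode
    (trans (sym (involutive C))
      (trans (cong φ (sym (N.decode-injective eq))) (involutive D)))

-- `place` lists the points in reading order, which is reversed for the patterns with A.
-- `place-injective` recovers the start alone, since the start determines the occurrence.
record Model (p : MeshPattern 3) (κ : Kind) (f : Bool) : Set where
  field
    coding            : Coding
    place             : ∀ {n} → Fin n → Fin n → Fin n → Vec (Fin n) 3
    place-injective   : ∀ {n} {s u v s′ u′ v′ : Fin n} → place s u v ≡ place s′ u′ v′ → s ≡ s′
    place-surjective  : ∀ {n} (is : Vec (Fin n) 3) → ∃ λ s → ∃₂ λ u v → place s u v ≡ is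
    occurrence⇒core   : ∀ {n} (C : Code n) {s u v} →
                        IsOccurrence p (Coding.decode coding C) (place s u v) → CoreC κ f C s u v
    core⇒occurrence   : ∀ {n} (C : Code n) {s u v} →
                        CoreC κ f C s u v → IsOccurrence p (Coding.decode coding C) (place s u v)

module _ {p q κ κ′ f} (M : Model p κ f) (N : Model q κ′ f) where
  private
    module M = Model M
    module N = Model N

  -- Occurrences are matched by their starts: an occurrence of `p` gives an event, `imp` carries it
  -- over, and `event⇒core` yields an occurrence of `q`. By `core-unique`, different occurrences of
  -- `p` have different starts.
  occ-mono : ∀ {n} {C D : Code n} → (∀ {s t} → Event κ f C s t → Event κ′ f D s t) →
             occ p (Coding.decode (Model.coding M) C) ≤ occ q (Coding.decode (Model.coding N) D)
  occ-mono {n} {C} {D} imp =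
    filter-mono-≤ (isOccurrence? p (Coding.decode (Model.coding M) C)) (isOccurrence? q (Coding.decode (Model.coding N) D))
                  (allVecs n 3) (allVecs n 3) SameStart (allVecs-unique n 3) total injective
    where
    SameStart : Vec (Fin n) 3 → Vec (Fin n) 3 → Set
    SameStart is js = ∃ λ s → ∃₂ λ u v → ∃₂ λ u′ v′ → M.place s u v ≡ is × N.place s u′ v′ ≡ js

    total : ∀ {is} → is ∈ allVecs n 3 → IsOccurrence p (Coding.decode (Model.coding M) C) is →
            ∃ λ js → js ∈ allVecs n 3 × IsOccurrence q (Coding.decode (Model.coding N) D) js × SameStart is js
    total {is} _ o with M.place-surjective is
    ... | s , u , v , refl with event⇒core D (imp (core⇒event C (M.occurrence⇒core C o)))
    ...   | u′ , v′ , O , _ = N.place s u′ v′ , ∈-allVecs _ , N.core⇒occurrence D O ,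
            s , u , v , u′ , v′ , refl , refl

    injective : ∀ {is is′ js} → IsOccurrence p (Coding.decode (Model.coding M) C) is →
                IsOccurrence p (Coding.decode (Model.coding M) C) is′ →
                SameStart is js → SameStart is′ js → is ≡ is′
    injective o o′ (s , u , v , _ , _ , refl , refl) (_ , u′ , v′ , _ , _ , refl , eq)
      with refl ← N.place-injective eq =
      let u≡ , v≡ = core-unique C (M.occurrence⇒core C o) (M.occurrence⇒core C o′) in cong₂ (M.place s) u≡ v≡

occ-recode : ∀ {p q κ κ′ f} (M : Model p κ f) (N : Model q κ′ f) (r : Recoding κ κ′)
             {n} (C : Code n) →
             occ p (Coding.decode (Model.coding M) C) ≡
             occ q (Coding.decode (Model.coding N) (Recoding.recode r C))
occ-recode {p} {q} M N r {n} C = ≤-antisym (occ-mono M N {n} {C} {Recoding.recode r C} (Recoding.event⁺ r))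
  -- `event⁻` leads to the code recoded twice, which is `C` again.
  (subst (λ D → occ q (Coding.decode (Model.coding N) (Recoding.recode r C)) ≤
                occ p (Coding.decode (Model.coding M) D))
         (Recoding.involutive r C)
         (occ-mono N M {n} {Recoding.recode r C} {Recoding.recode r (Recoding.recode r C)} (Recoding.event⁻ r)))

equidistributed : ∀ {p q κ κ′ f} → Model p κ f → Model q κ′ f → Recoding κ κ′ → Equidistributed p q
equidistributed {p} {q} M N r n ℓ = ≤-antisym
  (fibre-mono-≤ (Model.coding M) (Model.coding N) {n} (occ p) (occ q)
                (Recoding.recode r) (Recoding.involutive r) (occ-recode M N r) ℓ)
  (fibre-mono-≤ (Model.coding N) (Model.coding M) {n} (occ q) (occ p)
                (Recoding.recode r) (Recoding.involutive r) (occ-recode N M (recoding-sym r)) ℓ)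

-- From shaded boxes to cores

Gap : ℕ → Vec ℕ 3 → ℕ → ℕ → Set
Gap N ps a x = bound N ps a < x × x < bound N ps (suc a)

sides₀₁₂ sides₁₂₃ : List ℕ
sides₀₁₂ = 0 ∷ 1 ∷ 2 ∷ []
sides₁₂₃ = 1 ∷ 2 ∷ 3 ∷ []

-- With `gap₀₁₂⁺`: the strips 0, 1, 2 together are everything before `r` apart from `p` and `q`.
-- Used for columns and rows, this makes the nine boxes of A one quadrant.
gap₀₁₂⁻ : ∀ {N p q r x a} → p < q → q < r → a ∈ sides₀₁₂ → Gap N (p ∷ q ∷ r ∷ []) a x → x < r × x ≢ p × x ≢ q
gap₀₁₂⁻ p<q q<r (here refl) (_ , x<p) =
  <-trans x<p (<-trans p<q q<r) , <⇒≢ x<p , <⇒≢ (<-trans x<p p<q)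
gap₀₁₂⁻ p<q q<r (there (here refl)) (p<x , x<q) = <-trans x<q q<r , >⇒≢ p<x , <⇒≢ x<q
gap₀₁₂⁻ p<q q<r (there (there (here refl))) (q<x , x<r) = x<r , >⇒≢ (<-trans p<q q<x) , >⇒≢ q<x

gap₀₁₂⁺ : ∀ {N p q r x} → 0 < x → x < r → x ≢ p → x ≢ q → ∃ λ a → a ∈ sides₀₁₂ × Gap N (p ∷ q ∷ r ∷ []) a x
gap₀₁₂⁺ {p = p} {q} {x = x} 0<x x<r x≢p x≢q with <-cmp x p | <-cmp x q
... | tri≈ _ x≡p _ | _             = contradiction x≡p x≢p
... | _            | tri≈ _ x≡q _  = contradiction x≡q x≢q
... | tri< x<p _ _ | _             = 0 , here refl , 0<x , x<p
... | tri> _ _ p<x | tri< x<q _ _  = 1 , there (here refl) , p<x , x<q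
... | tri> _ _ _   | tri> _ _ q<x  = 2 , there (there (here refl)) , q<x , x<r

gap₁₂₃⁻ : ∀ {N p q r x a} → p < q → q < r → a ∈ sides₁₂₃ → Gap N (p ∷ q ∷ r ∷ []) a x → p < x × x ≢ q × x ≢ r
gap₁₂₃⁻ p<q q<r (here refl) (p<x , x<q) = p<x , <⇒≢ x<q , <⇒≢ (<-trans x<q q<r)
gap₁₂₃⁻ p<q q<r (there (here refl)) (q<x , x<r) = <-trans p<q q<x , >⇒≢ q<x , <⇒≢ x<r
gap₁₂₃⁻ p<q q<r (there (there (here refl))) (r<x , _) =
  <-trans p<q (<-trans q<r r<x) , >⇒≢ (<-trans q<r r<x) , >⇒≢ r<x

gap₁₂₃⁺ : ∀ {N p q r x} → x < N → p < x → x ≢ q → x ≢ r → ∃ λ a → a ∈ sides₁₂₃ × Gap N (p ∷ q ∷ r ∷ []) a x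
gap₁₂₃⁺ {q = q} {r} {x} x<N p<x x≢q x≢r with <-cmp x q | <-cmp x r
... | tri≈ _ x≡q _ | _            = contradiction x≡q x≢q
... | _            | tri≈ _ x≡r _ = contradiction x≡r x≢r
... | tri< x<q _ _ | _            = 1 , here refl , p<x , x<q
... | tri> _ _ q<x | tri< x<r _ _ = 2 , there (here refl) , q<x , x<r
... | tri> _ _ _   | tri> _ _ r<x = 3 , there (there (here refl)) , r<x , x<N

module _ {n} (π : Vec (Fin n) n) (is : Vec (Fin n) 3) {vs : Vec ℕ 3}
         (sorted : sortV (Vec.map (λ i → suc (toℕ (lookup π i))) is) ≡ vs) where

  private
    ps : Vec ℕ 3
    ps = Vec.map (λ i → suc (toℕ i)) is

  -- Stated with the explicit `vs` in place of `sortV`, so that `bound` computes.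
  InBox : ℕ × ℕ → Fin n → Set
  InBox (a , b) m = Gap (suc n) ps a (suc (toℕ m)) × Gap (suc n) vs b (suc (toℕ (lookup π m)))

  boxEmpty⁻ : ∀ {a b} → BoxEmpty π is (a , b) → ∀ m → ¬ InBox (a , b) m
  boxEmpty⁻ {b = b} e m ((p₁ , p₂) , (v₁ , v₂)) = fromAllFin e m
    (p₁ , p₂ , subst (λ vs → bound (suc n) vs b < suc (toℕ (lookup π m))) (sym sorted) v₁ ,
               subst (λ vs → suc (toℕ (lookup π m)) < bound (suc n) vs (suc b)) (sym sorted) v₂)

  boxEmpty⁺ : ∀ {a b} → (∀ m → ¬ InBox (a , b) m) → BoxEmpty π is (a , b)
  boxEmpty⁺ {b = b} e = toAllFin λ { m (p₁ , p₂ , v₁ , v₂) → e m ((p₁ , p₂) ,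
    (subst (λ vs → bound (suc n) vs b < suc (toℕ (lookup π m))) sorted v₁ ,
     subst (λ vs → suc (toℕ (lookup π m)) < bound (suc n) vs (suc b)) sorted v₂)) }

  boxes⁻ : ∀ {as bs} → All (BoxEmpty π is) (cartesianProduct as bs) →
           ∀ {a b} → a ∈ as → b ∈ bs → ∀ m → ¬ InBox (a , b) m
  boxes⁻ es {a} {b} a∈ b∈ = boxEmpty⁻ {a} {b} (All.lookup es (∈-cartesianProduct⁺ a∈ b∈))

  boxes⁺ : ∀ {as bs} → (∀ {a b} → a ∈ as → b ∈ bs → ∀ m → ¬ InBox (a , b) m) →
           All (BoxEmpty π is) (cartesianProduct as bs)
  boxes⁺ {as} {bs} h = All.tabulate λ { {a , b} ab∈ →
    let a∈ , b∈ = ∈-cartesianProduct⁻ as bs ab∈ in boxEmpty⁺ {a} {b} (h a∈ b∈) }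

strictlyIncreasing⁻ : ∀ {n} {i j k : Fin n} → StrictlyIncreasing (i ∷ j ∷ k ∷ []) → i Fin.< j × j Fin.< k
strictlyIncreasing⁻ inc = fromAllFin (fromAllFin inc zero) (suc zero) (s≤s z≤n) ,
                          fromAllFin (fromAllFin inc (suc zero)) (suc (suc zero)) (s≤s (s≤s z≤n))

strictlyIncreasing⁺ : ∀ {n} {i j k : Fin n} → i Fin.< j → j Fin.< k → StrictlyIncreasing (i ∷ j ∷ k ∷ [])
strictlyIncreasing⁺ {n} {i} {j} {k} i<j j<k = toAllFin λ a → toAllFin λ b → increasing a b
  where
  is : Vec (Fin n) 3
  is = i ∷ j ∷ k ∷ []
  increasing : ∀ a b → toℕ a < toℕ b → toℕ (lookup is a) < toℕ (lookup is b)
  increasing zero             (suc zero)       _ = i<j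
  increasing zero             (suc (suc zero)) _ = <-trans i<j j<k
  increasing (suc zero)       (suc (suc zero)) _ = j<k
  increasing (suc zero)       (suc zero)       (s≤s ())
  increasing (suc (suc zero)) (suc zero)       (s≤s ())
  increasing (suc (suc zero)) (suc (suc zero)) (s≤s (s≤s ()))

-- lo, mi, hi select the entries of a word x y z in increasing order if it is order-isomorphic to τ.
record Sorts (τ : Vec (Fin 3) 3) (lo mi hi : ∀ {A : Set} → A → A → A → A) : Set where
  field
    order⁻ : ∀ {n} (x y z : Fin n) → OrderIso (x ∷ y ∷ z ∷ []) τ →
             lo x y z Fin.< mi x y z × mi x y z Fin.< hi x y z
    order⁺ : ∀ {n} (x y z : Fin n) → lo x y z Fin.< mi x y z → mi x y z Fin.< hi x y z →
             OrderIso (x ∷ y ∷ z ∷ []) τ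
    sort   : ∀ x y z → lo x y z < mi x y z → mi x y z < hi x y z →
             sortV (x ∷ y ∷ z ∷ []) ≡ lo x y z ∷ mi x y z ∷ hi x y z ∷ []

insert-≤ : ∀ {k x y} {ys : Vec ℕ k} → x ≤ y → insert x (y ∷ ys) ≡ x ∷ y ∷ ys
insert-≤ {x = x} {y} x≤y with x ≤? y
... | yes _  = refl
... | no x≰y = contradiction x≤y x≰y

insert-> : ∀ {k x y} {ys : Vec ℕ k} → y < x → insert x (y ∷ ys) ≡ y ∷ insert x ys
insert-> {x = x} {y} y<x with x ≤? y
... | yes x≤y = contradiction x≤y (<⇒≱ y<x)
... | no _    = refl

both : ∀ {a b c d} → a < b → c < d → (a < b → c < d) × (c < d → a < b)
both a<b c<d = (λ _ → c<d) , (λ _ → a<b)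

neither : ∀ {a b c d} → b ≤ a → d ≤ c → (a < b → c < d) × (c < d → a < b)
neither b≤a d≤c = (λ a<b → contradiction a<b (≤⇒≯ b≤a)) , (λ c<d → contradiction c<d (≤⇒≯ d≤c))

sorts-123 : Sorts p123 (λ x y z → x) (λ x y z → y) (λ x y z → z)
sorts-123 = record { order⁻ = order⁻ ; order⁺ = order⁺ ; sort = sort }
  where
  order⁻ : ∀ {n} (x y z : Fin n) → OrderIso (x ∷ y ∷ z ∷ []) p123 → x Fin.< y × y Fin.< z
  order⁻ x y z o = proj₂ (fromAllFin (fromAllFin o zero) (suc zero)) (s≤s z≤n) ,
                   proj₂ (fromAllFin (fromAllFin o (suc zero)) (suc (suc zero))) (s≤s (s≤s z≤n))

  order⁺ : ∀ {n} (x y z : Fin n) → x Fin.< y → y Fin.< z → OrderIso (x ∷ y ∷ z ∷ []) p123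
  order⁺ {n} x y z x<y y<z = toAllFin λ a → toAllFin λ b → iso a b
    where
    w : Vec (Fin n) 3
    w = x ∷ y ∷ z ∷ []
    iso : ∀ a b → (lookup w a Fin.< lookup w b → lookup p123 a Fin.< lookup p123 b) ×
                  (lookup p123 a Fin.< lookup p123 b → lookup w a Fin.< lookup w b)
    iso zero             zero             = neither ≤-refl ≤-refl
    iso zero             (suc zero)       = both x<y (s≤s z≤n)
    iso zero             (suc (suc zero)) = both (<-trans x<y y<z) (s≤s z≤n)
    iso (suc zero)       zero             = neither (<⇒≤ x<y) z≤n
    iso (suc zero)       (suc zero)       = neither ≤-refl ≤-refl
    iso (suc zero)       (suc (suc zero)) = both y<z (s≤s (s≤s z≤n))
    iso (suc (suc zero)) zero             = neither (<⇒≤ (<-trans x<y y<z)) z≤n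
    iso (suc (suc zero)) (suc zero)       = neither (<⇒≤ y<z) (s≤s z≤n)
    iso (suc (suc zero)) (suc (suc zero)) = neither ≤-refl ≤-refl

  sort : ∀ x y z → x < y → y < z → sortV (x ∷ y ∷ z ∷ []) ≡ x ∷ y ∷ z ∷ []
  sort x y z x<y y<z = trans (cong (insert x) (insert-≤ (<⇒≤ y<z))) (insert-≤ (<⇒≤ x<y))

sorts-132 : Sorts p132 (λ x y z → x) (λ x y z → z) (λ x y z → y)
sorts-132 = record { order⁻ = order⁻ ; order⁺ = order⁺ ; sort = sort }
  where
  order⁻ : ∀ {n} (x y z : Fin n) → OrderIso (x ∷ y ∷ z ∷ []) p132 → x Fin.< z × z Fin.< y
  order⁻ x y z o = proj₂ (fromAllFin (fromAllFin o zero) (suc (suc zero))) (s≤s z≤n) ,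
                   proj₂ (fromAllFin (fromAllFin o (suc (suc zero))) (suc zero)) (s≤s (s≤s z≤n))

  order⁺ : ∀ {n} (x y z : Fin n) → x Fin.< z → z Fin.< y → OrderIso (x ∷ y ∷ z ∷ []) p132
  order⁺ {n} x y z x<z z<y = toAllFin λ a → toAllFin λ b → iso a b
    where
    w : Vec (Fin n) 3
    w = x ∷ y ∷ z ∷ []
    iso : ∀ a b → (lookup w a Fin.< lookup w b → lookup p132 a Fin.< lookup p132 b) ×
                  (lookup p132 a Fin.< lookup p132 b → lookup w a Fin.< lookup w b)
    iso zero             zero             = neither ≤-refl ≤-refl
    iso zero             (suc zero)       = both (<-trans x<z z<y) (s≤s z≤n)
    iso zero             (suc (suc zero)) = both x<z (s≤s z≤n)
    iso (suc zero)       zero             = neither (<⇒≤ (<-trans x<z z<y)) z≤n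
    iso (suc zero)       (suc zero)       = neither ≤-refl ≤-refl
    iso (suc zero)       (suc (suc zero)) = neither (<⇒≤ z<y) (s≤s z≤n)
    iso (suc (suc zero)) zero             = neither (<⇒≤ x<z) z≤n
    iso (suc (suc zero)) (suc zero)       = both z<y (s≤s (s≤s z≤n))
    iso (suc (suc zero)) (suc (suc zero)) = neither ≤-refl ≤-refl

  sort : ∀ x y z → x < z → z < y → sortV (x ∷ y ∷ z ∷ []) ≡ x ∷ z ∷ y ∷ []
  sort x y z x<z z<y = trans (cong (insert x) (insert-> z<y)) (insert-≤ (<⇒≤ x<z))

-- For a literal flag this reduces to the box lists of the theorem, so both families share one
-- proof.
addIf : Bool → ℕ × ℕ → List (ℕ × ℕ) → List (ℕ × ℕ)
addIf true  c bs = c ∷ bs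
addIf false c bs = bs

addIf⁻ : ∀ f {c bs} {P : ℕ × ℕ → Set} → All P (addIf f c bs) → All P bs × (T f → P c)
addIf⁻ true  (p ∷ ps) = ps , λ _ → p
addIf⁻ false ps       = ps , λ ()

addIf⁺ : ∀ f {c bs} {P : ℕ × ℕ → Set} → All P bs → (T f → P c) → All P (addIf f c bs)
addIf⁺ true  ps p = p _ ∷ ps
addIf⁺ false ps _ = ps

module _ (κ : Kind) {n} (π : Vec (Fin n) n) (π-inj : OneToOne π) where

  value : Fin n → ℕ
  value i = toℕ (lookup π i)

  private
    LeftOf RightOf Under Over : Fin n → Fin n → Set
    LeftOf  i j = i Fin.< j
    RightOf i j = j Fin.< i
    Under   i j = value i < value j
    Over    i j = value j < value i

    suc-value≢ : ∀ {m i} → m ≢ i → suc (value m) ≢ suc (value i)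
    suc-value≢ m≢i eq = m≢i (π-inj (toℕ-injective (suc-injective eq)))

    suc-toℕ≢ : ∀ {m i : Fin n} → m ≢ i → suc (toℕ m) ≢ suc (toℕ i)
    suc-toℕ≢ m≢i eq = m≢i (toℕ-injective (suc-injective eq))

    ≢-oneOf : ∀ {m x s u v : Fin n} → OneOf x s u v → m ≢ s → m ≢ u → m ≢ v → m ≢ x
    ≢-oneOf (inj₁ refl)        m≢s _ _ = m≢s
    ≢-oneOf (inj₂ (inj₁ refl)) _ m≢u _ = m≢u
    ≢-oneOf (inj₂ (inj₂ refl)) _ _ m≢v = m≢v

    fin<⇒≢ : ∀ {i j : Fin n} → toℕ i < toℕ j → i ≢ j
    fin<⇒≢ lt refl = <-irrefl refl lt

  module _ (f : Bool) {s u v : Fin n} where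
    private
      lo mi hi : Fin n
      lo = low κ s u v
      mi = mid κ s u v
      hi = top κ s u v

      lo-eq : low κ (suc (value s)) (suc (value u)) (suc (value v)) ≡ suc (value lo)
      lo-eq = low-map (ℕ.suc ∘ value) κ {s} {u} {v}
      mi-eq : mid κ (suc (value s)) (suc (value u)) (suc (value v)) ≡ suc (value mi)
      mi-eq = mid-map (ℕ.suc ∘ value) κ {s} {u} {v}
      hi-eq : top κ (suc (value s)) (suc (value u)) (suc (value v)) ≡ suc (value hi)
      hi-eq = top-map (ℕ.suc ∘ value) κ {s} {u} {v}

      lo-eqF : low κ (lookup π s) (lookup π u) (lookup π v) ≡ lookup π lo
      lo-eqF = low-map (lookup π) κ {s} {u} {v}
      mi-eqF : mid κ (lookup π s) (lookup π u) (lookup π v) ≡ lookup π mi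
      mi-eqF = mid-map (lookup π) κ {s} {u} {v}
      hi-eqF : top κ (lookup π s) (lookup π u) (lookup π v) ≡ lookup π hi
      hi-eqF = top-map (lookup π) κ {s} {u} {v}

    module _ {τ : Vec (Fin 3) 3}
             (sorts : Sorts τ (λ x y z → low κ z y x) (λ x y z → mid κ z y x) (λ x y z → top κ z y x)) where
      private
        module τ = Sorts sorts

        is : Vec (Fin n) 3
        is = v ∷ u ∷ s ∷ []

        sortedA : value lo < value mi → value mi < value hi →
                  sortV (Vec.map (λ i → suc (toℕ (lookup π i))) is) ≡
                  suc (value lo) ∷ suc (value mi) ∷ suc (value hi) ∷ []
        sortedA l<m m<h = trans
          (τ.sort (suc (value v)) (suc (value u)) (suc (value s))
            (subst₂ _<_ (sym lo-eq) (sym mi-eq) (s≤s l<m)) (subst₂ _<_ (sym mi-eq) (sym hi-eq) (s≤s m<h)))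
          (cong₂ _∷_ lo-eq (cong₂ _∷_ mi-eq (cong (_∷ []) hi-eq)))

      -- The boxes A cover what lies left of the last and below the highest chosen point. Read from
      -- right to left, the last one is `s`, so this is the region of `Core`, with (3,3) as the
      -- opposite corner.
      occurrenceA⁻ : IsOccurrence (mesh τ (addIf f (3 , 3) boxesA)) π is → Core κ f RightOf Under s u v
      occurrenceA⁻ (inc , iso , boxes) = core u<s v<u l<m m<h region corner
        where
        v<u : v Fin.< u
        v<u = proj₁ (strictlyIncreasing⁻ inc)
        u<s : u Fin.< s
        u<s = proj₂ (strictlyIncreasing⁻ inc)
        order = τ.order⁻ (lookup π v) (lookup π u) (lookup π s) iso
        l<m : value lo < value mi
        l<m = subst₂ Fin._<_ lo-eqF mi-eqF (proj₁ order)
        m<h : value mi < value hi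
        m<h = subst₂ Fin._<_ mi-eqF hi-eqF (proj₂ order)
        sorted = sortedA l<m m<h

        region : ∀ m → m Fin.< s → value m < value hi → m ≡ u ⊎ m ≡ v
        region m m<s m<hi with m Fin.≟ u | m Fin.≟ v
        ... | yes m≡u | _       = inj₁ m≡u
        ... | no _    | yes m≡v = inj₂ m≡v
        ... | no m≢u  | no m≢v  =
          -- A further point of the region avoids the chosen positions and values, so it lies in
          -- some shaded column and some shaded row.
          let a , a∈ , ga = gap₀₁₂⁺ (s≤s z≤n) (s≤s m<s) (suc-toℕ≢ m≢v) (suc-toℕ≢ m≢u)
              b , b∈ , gb = gap₀₁₂⁺ (s≤s z≤n) (s≤s m<hi)
                              (suc-value≢ (≢-oneOf (low-oneOf κ {s} {u} {v}) (fin<⇒≢ m<s) m≢u m≢v))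
                              (suc-value≢ (≢-oneOf (mid-oneOf κ {s} {u} {v}) (fin<⇒≢ m<s) m≢u m≢v))
          in ⊥-elim (boxes⁻ π is sorted (proj₁ (addIf⁻ f boxes)) a∈ b∈ m (ga , gb))

        corner : T f → ∀ m → s Fin.< m → ¬ value hi < value m
        corner tf m s<m h<m = boxEmpty⁻ π is sorted {3} {3} (proj₂ (addIf⁻ f boxes) tf) m
          -- The outer bounds of box (3,3) are `suc n`, above every position and every value.
          ((s≤s s<m , s≤s (toℕ<n m)) , (s≤s h<m , s≤s (toℕ<n (lookup π m))))

      occurrenceA⁺ : Core κ f RightOf Under s u v → IsOccurrence (mesh τ (addIf f (3 , 3) boxesA)) π is
      occurrenceA⁺ (core u<s v<u l<m m<h region corner) =
        strictlyIncreasing⁺ v<u u<s ,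
        τ.order⁺ (lookup π v) (lookup π u) (lookup π s)
          (subst₂ Fin._<_ (sym lo-eqF) (sym mi-eqF) l<m) (subst₂ Fin._<_ (sym mi-eqF) (sym hi-eqF) m<h) ,
        addIf⁺ f (boxes⁺ π is sorted empty) cornerEmpty
        where
        sorted = sortedA l<m m<h

        empty : ∀ {a b} → a ∈ sides₀₁₂ → b ∈ sides₀₁₂ → ∀ m → ¬ InBox π is sorted (a , b) m
        empty a∈ b∈ m (ga , gb) with gap₀₁₂⁻ (s≤s v<u) (s≤s u<s) a∈ ga | gap₀₁₂⁻ (s≤s l<m) (s≤s m<h) b∈ gb
        ... | m<s , m≢v , m≢u | m<hi , _ with region m (≤-pred m<s) (≤-pred m<hi)
        ...   | inj₁ refl = m≢u refl
        ...   | inj₂ refl = m≢v refl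

        cornerEmpty : T f → BoxEmpty π is (3 , 3)
        cornerEmpty tf = boxEmpty⁺ π is sorted {3} {3} λ { m ((s<m , _) , (h<m , _)) →
          corner tf m (≤-pred s<m) (≤-pred h<m) }

    module _ {τ : Vec (Fin 3) 3} (sorts : Sorts τ (top κ) (mid κ) (low κ)) where
      private
        module τ = Sorts sorts

        is : Vec (Fin n) 3
        is = s ∷ u ∷ v ∷ []

        sortedB : value mi < value lo → value hi < value mi →
                  sortV (Vec.map (λ i → suc (toℕ (lookup π i))) is) ≡
                  suc (value hi) ∷ suc (value mi) ∷ suc (value lo) ∷ []
        sortedB m<l h<m = trans
          (τ.sort (suc (value s)) (suc (value u)) (suc (value v))
            (subst₂ _<_ (sym hi-eq) (sym mi-eq) (s≤s h<m)) (subst₂ _<_ (sym mi-eq) (sym lo-eq) (s≤s m<l)))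
          (cong₂ _∷_ hi-eq (cong₂ _∷_ mi-eq (cong (_∷ []) lo-eq)))

      -- The boxes B cover what lies right of the first and above the lowest chosen point. Upside
      -- down, the lowest one becomes `top`; hence `sorts` lists `top` first and `low` last.
      occurrenceB⁻ : IsOccurrence (mesh τ (addIf f (0 , 0) boxesB)) π is → Core κ f LeftOf Over s u v
      occurrenceB⁻ (inc , iso , boxes) = core s<u u<v m<l h<m region corner
        where
        s<u : s Fin.< u
        s<u = proj₁ (strictlyIncreasing⁻ inc)
        u<v : u Fin.< v
        u<v = proj₂ (strictlyIncreasing⁻ inc)
        order = τ.order⁻ (lookup π s) (lookup π u) (lookup π v) iso
        h<m : value hi < value mi
        h<m = subst₂ Fin._<_ hi-eqF mi-eqF (proj₁ order)
        m<l : value mi < value lo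
        m<l = subst₂ Fin._<_ mi-eqF lo-eqF (proj₂ order)
        sorted = sortedB m<l h<m

        region : ∀ m → s Fin.< m → value hi < value m → m ≡ u ⊎ m ≡ v
        region m s<m hi<m with m Fin.≟ u | m Fin.≟ v
        ... | yes m≡u | _       = inj₁ m≡u
        ... | no _    | yes m≡v = inj₂ m≡v
        ... | no m≢u  | no m≢v  =
          let m≢s = λ m≡s → fin<⇒≢ s<m (sym m≡s)
              a , a∈ , ga = gap₁₂₃⁺ (s≤s (toℕ<n m)) (s≤s s<m) (suc-toℕ≢ m≢u) (suc-toℕ≢ m≢v)
              b , b∈ , gb = gap₁₂₃⁺ (s≤s (toℕ<n (lookup π m))) (s≤s hi<m)
                              (suc-value≢ (≢-oneOf (mid-oneOf κ {s} {u} {v}) m≢s m≢u m≢v))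
                              (suc-value≢ (≢-oneOf (low-oneOf κ {s} {u} {v}) m≢s m≢u m≢v))
          in ⊥-elim (boxes⁻ π is sorted (proj₁ (addIf⁻ f boxes)) a∈ b∈ m (ga , gb))

        corner : T f → ∀ m → m Fin.< s → ¬ value m < value hi
        corner tf m m<s m<h = boxEmpty⁻ π is sorted {0} {0} (proj₂ (addIf⁻ f boxes) tf) m
          ((s≤s z≤n , s≤s m<s) , (s≤s z≤n , s≤s m<h))

      occurrenceB⁺ : Core κ f LeftOf Over s u v → IsOccurrence (mesh τ (addIf f (0 , 0) boxesB)) π is
      occurrenceB⁺ (core s<u u<v m<l h<m region corner) =
        strictlyIncreasing⁺ s<u u<v ,
        τ.order⁺ (lookup π s) (lookup π u) (lookup π v)
          (subst₂ Fin._<_ (sym hi-eqF) (sym mi-eqF) h<m) (subst₂ Fin._<_ (sym mi-eqF) (sym lo-eqF) m<l) ,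
        addIf⁺ f (boxes⁺ π is sorted empty) cornerEmpty
        where
        sorted = sortedB m<l h<m

        empty : ∀ {a b} → a ∈ sides₁₂₃ → b ∈ sides₁₂₃ → ∀ m → ¬ InBox π is sorted (a , b) m
        empty a∈ b∈ m (ga , gb) with gap₁₂₃⁻ (s≤s s<u) (s≤s u<v) a∈ ga | gap₁₂₃⁻ (s≤s h<m) (s≤s m<l) b∈ gb
        ... | s<m , m≢u , m≢v | hi<m , _ with region m (≤-pred s<m) (≤-pred hi<m)
        ...   | inj₁ refl = m≢u refl
        ...   | inj₂ refl = m≢v refl

        cornerEmpty : T f → BoxEmpty π is (0 , 0)
        cornerEmpty tf = boxEmpty⁺ π is sorted {0} {0} λ { m ((_ , m<s) , (_ , m<h)) →
          corner tf m (≤-pred m<s) (≤-pred m<h) }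

-- Reversal and complement

opposite-anti : ∀ {n} {i j : Fin n} → i Fin.< j → opposite j Fin.< opposite i
opposite-anti {n} {i} {j} i<j = subst₂ _<_ (sym (opposite-prop j)) (sym (opposite-prop i))
  (∸-monoʳ-< (s≤s i<j) (toℕ<n j))

opposite-anti⁻ : ∀ {n} {i j : Fin n} → opposite j Fin.< opposite i → i Fin.< j
opposite-anti⁻ {i = i} {j} lt =
  subst₂ Fin._<_ (opposite-involutive i) (opposite-involutive j) (opposite-anti lt)

opposite-injective : ∀ {n} {i j : Fin n} → opposite i ≡ opposite j → i ≡ j
opposite-injective {i = i} {j} eq =
  trans (sym (opposite-involutive i)) (trans (cong opposite eq) (opposite-involutive j))

heights-oneToOne : ∀ {n} (C : Code n) → OneToOne (heights C)
heights-oneToOne C eq = height-injective C (cong toℕ eq)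

rev : ∀ {n} → Vec (Fin n) n → Vec (Fin n) n
rev v = tabulate (lookup v ∘ opposite)

lookup-rev : ∀ {n} (v : Vec (Fin n) n) i → lookup (rev v) i ≡ lookup v (opposite i)
lookup-rev v = Vecₚ.lookup∘tabulate _

rev-involutive : ∀ {n} (v : Vec (Fin n) n) → rev (rev v) ≡ v
rev-involutive v = vec-ext λ i → trans (lookup-rev (rev v) i)
  (trans (lookup-rev v (opposite i)) (cong (lookup v) (opposite-involutive i)))

rev-oneToOne : ∀ {n} (v : Vec (Fin n) n) → OneToOne v → OneToOne (rev v)
rev-oneToOne v inj {i} {j} eq =
  opposite-injective (inj (trans (sym (lookup-rev v i)) (trans eq (lookup-rev v j))))

complement : ∀ {n} → Vec (Fin n) n → Vec (Fin n) n
complement = Vec.map opposite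

lookup-complement : ∀ {n} (v : Vec (Fin n) n) i → lookup (complement v) i ≡ opposite (lookup v i)
lookup-complement v i = Vecₚ.lookup-map i opposite v

complement-involutive : ∀ {n} (v : Vec (Fin n) n) → complement (complement v) ≡ v
complement-involutive v = vec-ext λ i → trans (lookup-complement (complement v) i)
  (trans (cong opposite (lookup-complement v i)) (opposite-involutive (lookup v i)))

complement-oneToOne : ∀ {n} (v : Vec (Fin n) n) → OneToOne v → OneToOne (complement v)
complement-oneToOne v inj {i} {j} eq =
  inj (opposite-injective (trans (sym (lookup-complement v i)) (trans eq (lookup-complement v j))))

codingVia : (g : ∀ {n} → Vec (Fin n) n → Vec (Fin n) n) → (∀ {n} (v : Vec (Fin n) n) → g (g v) ≡ v) →
            (∀ {n} (v : Vec (Fin n) n) → OneToOne v → OneToOne (g v)) → Coding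
codingVia g g-involutive g-oneToOne = record
  { decode            = λ C → g (heights C)
  ; decode-injective  = λ {_} {C} {D} eq → heights-injective
      (trans (sym (g-involutive (heights C))) (trans (cong g eq) (g-involutive (heights D))))
  ; decode-oneToOne   = λ C → g-oneToOne (heights C) (heights-oneToOne C)
  ; decode-surjective = λ π inj →
      let C , eq = heights-surjective (g π) (g-oneToOne π inj)
      in C , trans (cong g eq) (g-involutive π)
  }

revCoding complementCoding : Coding
revCoding        = codingVia rev rev-involutive rev-oneToOne
complementCoding = codingVia complement complement-involutive complement-oneToOne

module _ {κ : Kind} {f : Bool} {n : ℕ} (C : Code n) where
  private
    LeftOf RightOf Under Over : Fin n → Fin n → Set
    LeftOf  i j = i Fin.< j
    RightOf i j = j Fin.< i
    Under   i j = toℕ (lookup (rev (heights C)) i) < toℕ (lookup (rev (heights C)) j)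
    Over    i j = toℕ (lookup (complement (heights C)) j) < toℕ (lookup (complement (heights C)) i)

    rev-value : ∀ i → toℕ (lookup (rev (heights C)) (opposite i)) ≡ height C i
    rev-value i = cong toℕ (trans (lookup-rev (heights C) (opposite i))
                                  (cong (lookup (heights C)) (opposite-involutive i)))

    under⁺ : ∀ {i j} → Below C i j → Under (opposite i) (opposite j)
    under⁺ {i} {j} = subst₂ _<_ (sym (rev-value i)) (sym (rev-value j))

    under⁻ : ∀ {i j} → Under (opposite i) (opposite j) → Below C i j
    under⁻ {i} {j} = subst₂ _<_ (rev-value i) (rev-value j)

    over⁺ : ∀ {i j} → Below C i j → Over i j
    over⁺ {i} {j} lt = subst₂ Fin._<_
      (sym (lookup-complement (heights C) j)) (sym (lookup-complement (heights C) i))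
      (opposite-anti lt)

    over⁻ : ∀ {i j} → Over i j → Below C i j
    over⁻ {i} {j} lt = opposite-anti⁻
      (subst₂ Fin._<_ (lookup-complement (heights C) j) (lookup-complement (heights C) i) lt)

  core-rev⁺ : ∀ {s u v} → CoreC κ f C s u v → Core κ f RightOf Under (opposite s) (opposite u) (opposite v)
  core-rev⁺ = core-transport opposite opposite opposite-involutive opposite-anti under⁺ opposite-anti⁻ under⁻

  core-rev⁻ : ∀ {s u v} → Core κ f RightOf Under (opposite s) (opposite u) (opposite v) → CoreC κ f C s u v
  core-rev⁻ {s} {u} {v} O =
    -- The transport along `opposite` arrives at the doubly opposite points.
    subst (λ s → CoreC κ f C s u v) (opposite-involutive s)
      (subst₂ (CoreC κ f C (opposite (opposite s))) (opposite-involutive u) (opposite-involutive v)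
        (core-transport opposite opposite opposite-involutive opposite-anti
          (λ {i} {j} lt → under⁻ (subst₂ Under (sym (opposite-involutive i)) (sym (opposite-involutive j)) lt))
          opposite-anti⁻
          (λ {i} {j} lt → subst₂ Under (opposite-involutive i) (opposite-involutive j) (under⁺ lt)) O))

  core-complement⁺ : ∀ {s u v} → CoreC κ f C s u v → Core κ f LeftOf Over s u v
  core-complement⁺ = core-transport id id (λ _ → refl) id over⁺ id over⁻

  core-complement⁻ : ∀ {s u v} → Core κ f LeftOf Over s u v → CoreC κ f C s u v
  core-complement⁻ = core-transport id id (λ _ → refl) id over⁻ id over⁺

-- Models of the patterns and the conclusion

modelA : ∀ κ f {τ} → Sorts τ (λ x y z → low κ z y x) (λ x y z → mid κ z y x) (λ x y z → top κ z y x) →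
         Model (mesh τ (addIf f (3 , 3) boxesA)) κ f
modelA κ f sorts = record
  { coding           = revCoding
  ; place            = λ s u v → opposite v ∷ opposite u ∷ opposite s ∷ []
  ; place-injective  = λ eq → opposite-injective
      (Vecₚ.∷-injectiveˡ (Vecₚ.∷-injectiveʳ (Vecₚ.∷-injectiveʳ eq)))
  ; place-surjective = λ { (i ∷ j ∷ k ∷ []) → opposite k , opposite j , opposite i ,
      cong₂ _∷_ (opposite-involutive i)
        (cong₂ _∷_ (opposite-involutive j) (cong (_∷ []) (opposite-involutive k))) }
  ; occurrence⇒core  = λ C o → core-rev⁻ C
      (occurrenceA⁻ κ (rev (heights C)) (rev-oneToOne (heights C) (heights-oneToOne C)) f sorts o)
  ; core⇒occurrence  = λ C o →
      occurrenceA⁺ κ (rev (heights C)) (rev-oneToOne (heights C) (heights-oneToOne C)) f sorts (core-rev⁺ C o)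
  }

modelB : ∀ κ f {τ} → Sorts τ (top κ) (mid κ) (low κ) → Model (mesh τ (addIf f (0 , 0) boxesB)) κ f
modelB κ f sorts = record
  { coding           = complementCoding
  ; place            = λ s u v → s ∷ u ∷ v ∷ []
  ; place-injective  = Vecₚ.∷-injectiveˡ
  ; place-surjective = λ { (i ∷ j ∷ k ∷ []) → i , j , k , refl }
  ; occurrence⇒core  = λ C o → core-complement⁻ C
      (occurrenceB⁻ κ (complement (heights C)) (complement-oneToOne (heights C) (heights-oneToOne C)) f sorts o)
  ; core⇒occurrence  = λ C o →
      occurrenceB⁺ κ (complement (heights C)) (complement-oneToOne (heights C) (heights-oneToOne C)) f sorts
        (core-complement⁺ C o)
  }

pairwise-equidistributed : ∀ p₁ p₂ p₃ p₄ {f} → Model p₁ ₃₂₁ f → Model p₂ ₂₃₁ f →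
  Model p₃ ₃₂₁ f → Model p₄ ₃₁₂ f →
  Equidistributed p₁ p₂ × Equidistributed p₁ p₃ × Equidistributed p₁ p₄ ×
  Equidistributed p₂ p₃ × Equidistributed p₂ p₄ × Equidistributed p₃ p₄
pairwise-equidistributed p₁ p₂ p₃ p₄ m₁ m₂ m₃ m₄ =
  e₁₂ , e₁₃ , e₁₄ ,
  (λ n ℓ → trans (sym (e₁₂ n ℓ)) (e₁₃ n ℓ)) ,
  (λ n ℓ → trans (sym (e₁₂ n ℓ)) (e₁₄ n ℓ)) ,
  (λ n ℓ → trans (sym (e₁₃ n ℓ)) (e₁₄ n ℓ))
  where
  e₁₂ : Equidistributed p₁ p₂
  e₁₂ = equidistributed m₁ m₂ 321↔231
  e₁₃ : Equidistributed p₁ p₃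
  e₁₃ = equidistributed m₁ m₃ recoding-refl
  e₁₄ : Equidistributed p₁ p₄
  e₁₄ = equidistributed m₁ m₄ 321↔312

theorem4p3 :
  let A = boxesA
      B = boxesB
      A' = (3 , 3) ∷ boxesA
      B' = (0 , 0) ∷ boxesB
  in (Equidistributed (mesh p123 A) (mesh p132 A)
      × Equidistributed (mesh p123 A) (mesh p123 B)
      × Equidistributed (mesh p123 A) (mesh p132 B)
      × Equidistributed (mesh p132 A) (mesh p123 B)
      × Equidistributed (mesh p132 A) (mesh p132 B)
      × Equidistributed (mesh p123 B) (mesh p132 B))
   × (Equidistributed (mesh p123 A') (mesh p132 A')
      × Equidistributed (mesh p123 A') (mesh p123 B')
      × Equidistributed (mesh p123 A') (mesh p132 B')
      × Equidistributed (mesh p132 A') (mesh p123 B')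
      × Equidistributed (mesh p132 A') (mesh p132 B')
      × Equidistributed (mesh p123 B') (mesh p132 B'))
theorem4p3 =
  pairwise-equidistributed (mesh p123 boxesA) (mesh p132 boxesA) (mesh p123 boxesB) (mesh p132 boxesB)
    -- Reversal turns 123 and 132 into 321 and 231; complement turns them into 321 and 312.
    (modelA ₃₂₁ false sorts-123) (modelA ₂₃₁ false sorts-132)
    (modelB ₃₂₁ false sorts-123) (modelB ₃₁₂ false sorts-132) ,
  pairwise-equidistributed (mesh p123 ((3 , 3) ∷ boxesA)) (mesh p132 ((3 , 3) ∷ boxesA))
                           (mesh p123 ((0 , 0) ∷ boxesB)) (mesh p132 ((0 , 0) ∷ boxesB))
    (modelA ₃₂₁ true sorts-123) (modelA ₂₃₁ true sorts-132)
    (modelB ₃₂₁ true sorts-123) (modelB ₃₁₂ true sorts-132)
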